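{- Let $\Delta:\mathbf{\Lambda}\to\mathbf{\Lambda}\otimes\mathbf{\Lambda}$ be the coproduct on the ring $\mathbf{\Lambda}$ of symmetric functions in superspace. Then for every integer $i\ge 1$ (respectively $i\geq 0$ for the formulas involving tildes), $$\Delta e_i=\sum_{k+\ell=i} e_k\otimes e_\ell,\qquad \Delta\tilde e_i=\sum_{k+\ell=i}\left(\tilde e_k\otimes e_\ell+e_\ell\otimes\tilde e_k\right),$$ and $$\Delta h_i=\sum_{k+\ell=i} h_k\otimes h_\ell,\qquad \Delta\tilde h_i=\sum_{k+\ell=i}\left(\tilde h_k\otimes h_\ell+h_\ell\otimes\tilde h_k\right),$$ where all sums are over pairs of non-negative integers $(k,\ell)$.
   Context: Let $x_1,x_2,\dots$ be commuting variables and $\theta_1,\theta_2,\dots$ anticommuting variables ($\theta_i\theta_j=-\theta_j\theta_i$, $\theta_i^2=0$), the $x$'s commuting with the $\theta$'s. The ring $\mathbf{\Lambda}$ of symmetric functions in superspace is the ring of formal power series over $\mathbb Q$ of bounded degree in these variables that are invariant under simultaneous permutation of the pairs $(x_i,\theta_i)$. The fermionic degree is the degree in the $\theta$'s. A superpartition is a pair $\Lambda=(\Lambda^a;\Lambda^s)=(\Lambda_1,\dots,\Lambda_m;\Lambda_{m+1},\dots,\Lambda_N)$, where $\Lambda^a$ is a strictly decreasing sequence of $m$ non-negative integers and $\Lambda^s$ is a partition (trailing zeros are irrelevant). It is of type $(n|m)$ if $\sum_i\Lambda_i=n$ and $\Lambda^a$ has $m$ parts. The monomial symmetric function $m_\Lambda$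 is the sum of the distinct terms among $\theta_{\sigma(1)}\cdots\theta_{\sigma(m)}x_{\sigma(1)}^{\Lambda_1}\cdots x_{\sigma(N)}^{\Lambda_N}$ over permutations $\sigma\in S_N$ (with $\Lambda$ padded by zeros to length $N$), taken in the limit of infinitely many variables $N\to\infty$. For $r\ge1$ and $k\ge0$: $e_r=m_{(\emptyset;1^r)}$, $\tilde e_k=m_{(0;1^k)}$, $h_r=\sum_{\Lambda}m_\Lambda$ over superpartitions $\Lambda$ of type $(r|0)$, and $\tilde h_k=\sum_{\Lambda}(\Lambda_1+1)m_\Lambda$ over superpartitions $\Lambda$ of type $(k|1)$ (here $\Lambda_1$ is the unique part of $\Lambda^a$). Also $e_0=h_0=1$. $\mathbf{\Lambda}\otimes\mathbf{\Lambda}$ (over $\mathbb Q$) is identified with functions of two sets of variables $(x;\theta)$ and $(y;\phi)$, symmetric in each set separately, with the $\theta$'s and $\phi$'s anticommuting with each other; $f\otimes g$ corresponds to $f(x;\theta)g(y;\phi)$. Thus $(f_1\otimes g_1)(f_2\otimes g_2)=(-1)^{ab}f_1f_2\otimes g_1g_2$ when $g_1,f_2$ have fermionic degrees $a,b$. The coproduct is $(\Delta f)(x,y;\theta,\phi)=f(x,y;\theta,\phi)$, i.e. $f$ evaluated on the union of the two sets of variables. -}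

module Defs where

open import Data.Bool using (Bool; true; false; if_then_else_)
import Data.Bool.Properties as Bool
open import Data.Empty using (⊥-elim)
import Data.Integer as ℤ
open import Data.List as List
  using (List; []; _∷_; _++_; _∷ʳ_; [_]; map; foldr; length; replicate; concatMap;
         upTo; cartesianProduct; cartesianProductWith; filter; deduplicate)
import Data.List.Properties as List
open import Data.List.Membership.Propositional using (_∈_; _∉_)
open import Data.List.Membership.Propositional.Properties
open import Data.List.Relation.Binary.Permutation.Propositional
  using (_↭_; ↭-sym; ↭-trans; ↭-refl; ↭-prep; ↭-swap)
import Data.List.Relation.Binary.Permutation.Propositional as Perm
import Data.List.Relation.Binary.Permutation.Propositional.Properties as Perm
open import Data.List.Relation.Unary.All as All using (All; []; _∷_)
import Data.List.Relation.Unary.All.Properties as All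
open import Data.List.Relation.Unary.AllPairs as AllPairs using (AllPairs; []; _∷_)
import Data.List.Relation.Unary.AllPairs.Properties as AllPairs
open import Data.List.Relation.Unary.Any using (here; there)
open import Data.List.Relation.Unary.Linked as Linked using (Linked; []; [-]; _∷_)
open import Data.List.Relation.Unary.Unique.Propositional using (Unique)
import Data.List.Relation.Unary.Unique.Propositional.Properties as Unique
import Data.List.Relation.Unary.Unique.DecPropositional.Properties as DecUnique
open import Data.Maybe using (Maybe; just; nothing; is-just)
open import Data.Maybe.Properties using (just-injective)
open import Data.Nat as ℕ using (ℕ; zero; suc; _≤_; _<_; _>_; _≥_; _∸_; z≤n; s≤s)
import Data.Nat.ListAction as ℕ using (sum)
import Data.Nat.ListAction.Properties as ℕ using (sum-++; sum-↭)
import Data.Nat.Properties as ℕ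
open import Data.Product using (Σ; ∃; ∃-syntax; _×_; _,_; proj₁; proj₂)
import Data.Product.Properties as Product
open import Data.Rational using (ℚ; 0ℚ; 1ℚ; _+_; _*_; -_; _-_; _/_)
import Data.Rational.Properties as ℚ
open import Algebra.Properties.Group ℚ.+-0-group using (⁻¹-involutive)
open import Data.Sign as Sign using (Sign; opposite)
import Data.Sign.Properties as Sign
open import Data.Sum using (_⊎_; inj₁; inj₂)
open import Data.Vec as Vec using (Vec; []; _∷_)
import Data.Vec.Properties as Vec
import Data.Vec.Relation.Unary.Linked as VecLinked
open import Function using (_∘_; id)
open import Relation.Binary.Definitions using (DecidableEquality; tri<; tri≈; tri>)
open import Relation.Binary.PropositionalEquality hiding ([_])
open import Relation.Nullary using (¬_; Dec; yes; no; does; contradiction)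
open import Relation.Nullary.Decidable using (map′; _×-dec_; dec-true; dec-false)

-- The monomial θ_{j₁} ⋯ θ_{jₖ} x^α  (j₁ < ⋯ < jₖ) is the list whose j-th
-- entry is (j ∈ {j₁,…,jₖ} , αⱼ).  Lists that differ by trailing entries 𝟙
-- denote the same monomial in x₁,x₂,…;θ₁,θ₂,… .
Cell : Set
Cell = Bool × ℕ

Mono : Set
Mono = List Cell

𝟙 : Cell
𝟙 = false , 0

_≟ᵐ_ : DecidableEquality Mono
_≟ᵐ_ = List.≡-dec (Product.≡-dec Bool._≟_ ℕ._≟_)

isOne : Mono → Bool
isOne []                  = true
isOne ((false , zero) ∷ w) = isOne w
isOne (_ ∷ w)              = false

-- Total degree in the x's and the θ's.
cellDegree : Cell → ℕ
cellDegree (ε , α) = (if ε then 1 else 0) ℕ.+ α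

degree : Mono → ℕ
degree w = ℕ.sum (map cellDegree w)

⟦_⟧ : Sign → ℚ
⟦ Sign.+ ⟧ = 1ℚ
⟦ Sign.- ⟧ = - 1ℚ

-- A product of θ's in arbitrary order, times a monomial in the x's.  The
-- j-th entry is (just k , αⱼ) if θⱼ occurs in the product, and then the
-- θ's are multiplied in increasing order of the labels k; it is
-- (nothing , αⱼ) if θⱼ does not occur.
Term : Set
Term = List (Maybe ℕ × ℕ)

forgetCell : Maybe ℕ × ℕ → Cell
forgetCell (l , α) = is-just l , α

forget : Term → Mono
forget = map forgetCell

inversion : ℕ → ℕ → Sign
inversion l k = if does (l ℕ.<? k) then Sign.- else Sign.+

-- (-1) to the number of labels in t that are smaller than k.
smaller : ℕ → Term → Sign
smaller k []                 = Sign.+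
smaller k ((nothing , _) ∷ t) = smaller k t
smaller k ((just l , _) ∷ t)  = inversion l k Sign.* smaller k t

-- t equals sgn t times the monomial forget t.
sgn : Term → Sign
sgn []                 = Sign.+
sgn ((nothing , _) ∷ t) = sgn t
sgn ((just k , _) ∷ t)  = smaller k t Sign.* sgn t

-- The monomial w itself, each θ labelled by its position (counted from k).
ordered : ℕ → Mono → Term
ordered k []              = []
ordered k ((true , α) ∷ w)  = (just k , α) ∷ ordered (suc k) w
ordered k ((false , α) ∷ w) = (nothing , α) ∷ ordered (suc k) w

-- Simultaneously permuting the pairs (xᵢ,θᵢ) turns the monomial w into the
-- product t, with t a rearrangement of the entries of ordered 0 w.
Symmetric : (Mono → ℚ) → Set
Symmetric f = ∀ w t → t ↭ ordered 0 w → f (forget t) ≡ ⟦ sgn t ⟧ * f w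

-- Power series in x₁,x₂,…;θ₁,θ₂,… given by their coefficients; stable says
-- that lists denoting the same monomial have the same coefficient.
record 𝚲 : Set where
  field
    coef      : Mono → ℚ
    stable    : ∀ w → coef (w ∷ʳ 𝟙) ≡ coef w
    symmetric : Symmetric coef
    bounded   : ∃[ d ] ∀ w → d < degree w → coef w ≡ 0ℚ

-- 𝚲 ⊗ 𝚲 as the space of functions of (x;θ) and (y;φ) symmetric in each set:
-- coef u v is the coefficient of u(x;θ) v(y;φ), where all the θ's stand to
-- the left of all the φ's.
record 𝚲⊗𝚲 : Set where
  field
    coef       : Mono → Mono → ℚ
    stableˣ    : ∀ u v → coef (u ∷ʳ 𝟙) v ≡ coef u v
    stableʸ    : ∀ u v → coef u (v ∷ʳ 𝟙) ≡ coef u v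
    symmetricˣ : ∀ v → Symmetric (λ u → coef u v)
    symmetricʸ : ∀ u → Symmetric (λ v → coef u v)
    bounded    : ∃[ d ] ∀ u v → d < degree u ℕ.+ degree v → coef u v ≡ 0ℚ

infix 4 _≈_
_≈_ : 𝚲⊗𝚲 → 𝚲⊗𝚲 → Set
F ≈ G = ∀ u v → 𝚲⊗𝚲.coef F u v ≡ 𝚲⊗𝚲.coef G u v

∑ : ∀ {A : Set} → List A → (A → ℚ) → ℚ
∑ xs φ = foldr (λ x s → φ x + s) 0ℚ xs

∑-zero : ∀ {A : Set} (xs : List A) {φ : A → ℚ} → (∀ {y} → y ∈ xs → φ y ≡ 0ℚ) → ∑ xs φ ≡ 0ℚ
∑-zero []       h = refl
∑-zero (x ∷ xs) h = cong₂ _+_ (h (here refl)) (∑-zero xs (h ∘ there))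

∑-single : ∀ {A : Set} {xs : List A} {x : A} (φ : A → ℚ) → Unique xs → x ∈ xs →
           (∀ {y} → y ∈ xs → y ≢ x → φ y ≡ 0ℚ) → ∑ xs φ ≡ φ x
∑-single {xs = x ∷ xs} φ (x∉ ∷ _) (here refl) h =
  trans (cong (φ x +_) (∑-zero xs λ y∈ → h (there y∈) (λ eq → All.lookup x∉ y∈ (sym eq))))
        (ℚ.+-identityʳ (φ x))
∑-single {xs = z ∷ xs} {x} φ (z∉ ∷ uq) (there x∈) h =
  trans (cong₂ _+_ (h (here refl) (All.lookup z∉ x∈)) (∑-single φ uq x∈ (h ∘ there)))
        (ℚ.+-identityˡ (φ x))

swapSign : Cell → Cell → Sign
swapSign (true , _) (true , _) = Sign.-
swapSign _          _          = Sign.+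

⟦⟧-* : ∀ s t → ⟦ s Sign.* t ⟧ ≡ ⟦ s ⟧ * ⟦ t ⟧
⟦⟧-* Sign.+ Sign.+ = refl
⟦⟧-* Sign.+ Sign.- = refl
⟦⟧-* Sign.- Sign.+ = refl
⟦⟧-* Sign.- Sign.- = refl

⟦⟧-involutive : ∀ s q → ⟦ s ⟧ * (⟦ s ⟧ * q) ≡ q
⟦⟧-involutive s q = trans (sym (ℚ.*-assoc ⟦ s ⟧ ⟦ s ⟧ q))
  (trans (cong (_* q) (trans (sym (⟦⟧-* s s)) (cong ⟦_⟧ (Sign.s*s≡+ s)))) (ℚ.*-identityˡ q))

-- Distinct θ's carry distinct labels.
Apart : Maybe ℕ × ℕ → Maybe ℕ × ℕ → Set
Apart c d = ∀ k → proj₁ c ≡ just k → proj₁ d ≢ just k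

Apart-sym : ∀ c d → Apart c d → Apart d c
Apart-sym _ _ ap k p q = ap k q p

Apart-↭ : ∀ {s t} → s ↭ t → AllPairs Apart s → AllPairs Apart t
Apart-↭ Perm.refl ap = ap
Apart-↭ (Perm.prep c p) (h ∷ ap) = Perm.All-resp-↭ p h ∷ Apart-↭ p ap
Apart-↭ (Perm.swap c d p) ((cd ∷ hc) ∷ hd ∷ ap) =
  (Apart-sym c d cd ∷ Perm.All-resp-↭ p hd) ∷ Perm.All-resp-↭ p hc ∷ Apart-↭ p ap
Apart-↭ (Perm.trans p q) ap = Apart-↭ q (Apart-↭ p ap)

smaller-↭ : ∀ k {s t} → s ↭ t → smaller k s ≡ smaller k t
smaller-↭ k Perm.refl = refl
smaller-↭ k (Perm.prep (nothing , _) p) = smaller-↭ k p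
smaller-↭ k (Perm.prep (just l , _) p) = cong (inversion l k Sign.*_) (smaller-↭ k p)
smaller-↭ k (Perm.swap (nothing , _) (nothing , _) p) = smaller-↭ k p
smaller-↭ k (Perm.swap (nothing , _) (just l , _) p) = cong (inversion l k Sign.*_) (smaller-↭ k p)
smaller-↭ k (Perm.swap (just l , _) (nothing , _) p) = cong (inversion l k Sign.*_) (smaller-↭ k p)
smaller-↭ k {t = _ ∷ _ ∷ t} (Perm.swap (just l , _) (just l′ , _) p) =
  trans (cong (λ z → a Sign.* (b Sign.* z)) (smaller-↭ k p))
  (trans (sym (Sign.*-assoc a b _)) (trans (cong (Sign._* smaller k t) (Sign.*-comm a b)) (Sign.*-assoc b a _)))
  where
  a = inversion l k
  b = inversion l′ k
smaller-↭ k (Perm.trans p q) = trans (smaller-↭ k p) (smaller-↭ k q)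

inversion-flip : ∀ k l → k ≢ l → inversion l k ≡ opposite (inversion k l)
inversion-flip k l k≢l with ℕ.<-cmp k l
... | tri< k<l _ l≮k rewrite dec-true (k ℕ.<? l) k<l | dec-false (l ℕ.<? k) l≮k = refl
... | tri≈ _ k≡l _   = ⊥-elim (k≢l k≡l)
... | tri> k≮l _ l<k rewrite dec-true (l ℕ.<? k) l<k | dec-false (k ℕ.<? l) k≮l = refl

sgn-swap : ∀ p c d q → Apart c d →
           sgn (p ++ c ∷ d ∷ q) ≡ swapSign (forgetCell c) (forgetCell d) Sign.* sgn (p ++ d ∷ c ∷ q)
sgn-swap ((nothing , _) ∷ p) c d q ap = sgn-swap p c d q ap
sgn-swap ((just k , _) ∷ p) c d q ap =
  trans (cong₂ Sign._*_ (smaller-↭ k (Perm.++⁺ˡ p (↭-swap c d ↭-refl))) (sgn-swap p c d q ap))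
  (trans (sym (Sign.*-assoc a b e)) (trans (cong (Sign._* e) (Sign.*-comm a b)) (Sign.*-assoc b a e)))
  where
  a = smaller k (p ++ d ∷ c ∷ q)
  b = swapSign (forgetCell c) (forgetCell d)
  e = sgn (p ++ d ∷ c ∷ q)
sgn-swap [] (nothing , _) (nothing , _) q ap = refl
sgn-swap [] (nothing , _) (just _ , _) q ap = refl
sgn-swap [] (just _ , _) (nothing , _) q ap = refl
sgn-swap [] (just k , _) (just l , _) q ap
  rewrite inversion-flip k l (λ k≡l → ap k refl (cong just (sym k≡l))) =
  lemma (inversion k l) (smaller k q) (smaller l q) (sgn q)
  where
  lemma : ∀ i a b s → (opposite i Sign.* a) Sign.* (b Sign.* s) ≡
                      opposite ((i Sign.* b) Sign.* (a Sign.* s))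
  lemma Sign.+ Sign.+ Sign.+ Sign.+ = refl
  lemma Sign.+ Sign.+ Sign.+ Sign.- = refl
  lemma Sign.+ Sign.+ Sign.- Sign.+ = refl
  lemma Sign.+ Sign.+ Sign.- Sign.- = refl
  lemma Sign.+ Sign.- Sign.+ Sign.+ = refl
  lemma Sign.+ Sign.- Sign.+ Sign.- = refl
  lemma Sign.+ Sign.- Sign.- Sign.+ = refl
  lemma Sign.+ Sign.- Sign.- Sign.- = refl
  lemma Sign.- Sign.+ Sign.+ Sign.+ = refl
  lemma Sign.- Sign.+ Sign.+ Sign.- = refl
  lemma Sign.- Sign.+ Sign.- Sign.+ = refl
  lemma Sign.- Sign.+ Sign.- Sign.- = refl
  lemma Sign.- Sign.- Sign.+ Sign.+ = refl
  lemma Sign.- Sign.- Sign.+ Sign.- = refl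
  lemma Sign.- Sign.- Sign.- Sign.+ = refl
  lemma Sign.- Sign.- Sign.- Sign.- = refl

smaller-ordered : ∀ k j w → k ≤ j → smaller k (ordered j w) ≡ Sign.+
smaller-ordered k j [] _ = refl
smaller-ordered k j ((false , _) ∷ w) k≤j = smaller-ordered k (suc j) w (ℕ.m≤n⇒m≤1+n k≤j)
smaller-ordered k j ((true , _) ∷ w) k≤j
  rewrite dec-false (j ℕ.<? k) (ℕ.≤⇒≯ k≤j) = smaller-ordered k (suc j) w (ℕ.m≤n⇒m≤1+n k≤j)

sgn-ordered : ∀ k w → sgn (ordered k w) ≡ Sign.+
sgn-ordered k [] = refl
sgn-ordered k ((false , _) ∷ w) = sgn-ordered (suc k) w
sgn-ordered k ((true , _) ∷ w) =
  cong₂ Sign._*_ (smaller-ordered k (suc k) w (ℕ.n≤1+n k)) (sgn-ordered (suc k) w)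

forget-ordered : ∀ k w → forget (ordered k w) ≡ w
forget-ordered k [] = refl
forget-ordered k ((false , _) ∷ w) = cong (_ ∷_) (forget-ordered (suc k) w)
forget-ordered k ((true , _) ∷ w) = cong (_ ∷_) (forget-ordered (suc k) w)

ordered-labels : ∀ k j w → k < j → All (Apart (just k , 0)) (ordered j w)
ordered-labels k j [] _ = []
ordered-labels k j ((false , _) ∷ w) k<j = (λ _ _ ()) ∷ ordered-labels k (suc j) w (ℕ.m<n⇒m<1+n k<j)
ordered-labels k j ((true , _) ∷ w) k<j =
  (λ { _ refl refl → ℕ.<-irrefl refl k<j }) ∷ ordered-labels k (suc j) w (ℕ.m<n⇒m<1+n k<j)

ordered-apart : ∀ k w → AllPairs Apart (ordered k w)
ordered-apart k [] = []
ordered-apart k ((false , _) ∷ w) = All.universal (λ _ _ ()) _ ∷ ordered-apart (suc k) w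
ordered-apart k ((true , _) ∷ w) =
  All.map id (ordered-labels k (suc k) w ℕ.≤-refl) ∷ ordered-apart (suc k) w

ordered-++ : ∀ k p q → ordered k (p ++ q) ≡ ordered k p ++ ordered (k ℕ.+ length p) q
ordered-++ k [] q = cong (λ j → ordered j q) (sym (ℕ.+-identityʳ k))
ordered-++ k ((false , _) ∷ p) q rewrite ℕ.+-suc k (length p) = cong (_ ∷_) (ordered-++ (suc k) p q)
ordered-++ k ((true , _) ∷ p) q rewrite ℕ.+-suc k (length p) = cong (_ ∷_) (ordered-++ (suc k) p q)

-- Invariance under all permutations amounts to invariance under exchanges
-- of neighbouring pairs of variables.
Adjacent : (Mono → ℚ) → Set
Adjacent f = ∀ p c d q → f (p ++ c ∷ d ∷ q) ≡ ⟦ swapSign c d ⟧ * f (p ++ d ∷ c ∷ q)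

module _ (f : Mono → ℚ) (adj : Adjacent f) where

  private
    value : Term → ℚ
    value t = ⟦ sgn t ⟧ * f (forget t)

  value-swap : ∀ p c d q → Apart c d → value (p ++ c ∷ d ∷ q) ≡ value (p ++ d ∷ c ∷ q)
  value-swap p c d q ap
    rewrite sgn-swap p c d q ap
          | List.map-++ forgetCell p (c ∷ d ∷ q)
          | List.map-++ forgetCell p (d ∷ c ∷ q)
          | adj (forget p) (forgetCell c) (forgetCell d) (forget q)
          | ⟦⟧-* (swapSign (forgetCell c) (forgetCell d)) (sgn (p ++ d ∷ c ∷ q)) =
    trans (cong (_* (⟦ s ⟧ * y)) (ℚ.*-comm ⟦ s ⟧ x))
      (trans (ℚ.*-assoc x ⟦ s ⟧ (⟦ s ⟧ * y)) (cong (x *_) (⟦⟧-involutive s y)))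
    where
    s = swapSign (forgetCell c) (forgetCell d)
    x = ⟦ sgn (p ++ d ∷ c ∷ q) ⟧
    y = f (forget p ++ forgetCell d ∷ forgetCell c ∷ forget q)

  value-↭ : ∀ p {s t} → AllPairs Apart s → s ↭ t → value (p ++ s) ≡ value (p ++ t)
  value-↭ p ap Perm.refl = refl
  value-↭ p {_ ∷ s} {_ ∷ t} (_ ∷ ap) (Perm.prep c r) =
    subst₂ (λ a b → value a ≡ value b) (List.∷ʳ-++ p c s) (List.∷ʳ-++ p c t)
      (value-↭ (p ∷ʳ c) ap r)
  value-↭ p {_ ∷ _ ∷ s} {_ ∷ _ ∷ t} ((cd ∷ _) ∷ _ ∷ ap) (Perm.swap c d r) =
    trans (value-swap p c d s cd)
      (subst₂ (λ a b → value a ≡ value b) (List.++-assoc p (d ∷ c ∷ []) s) (List.++-assoc p (d ∷ c ∷ []) t)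
        (value-↭ (p ++ d ∷ c ∷ []) ap r))
  value-↭ p ap (Perm.trans r r′) = trans (value-↭ p ap r) (value-↭ p (Apart-↭ r ap) r′)

  adjacent⇒symmetric : Symmetric f
  adjacent⇒symmetric w t t↭w = begin
    f (forget t)                              ≡⟨ ⟦⟧-involutive (sgn t) _ ⟨
    ⟦ sgn t ⟧ * value t                       ≡⟨ cong (⟦ sgn t ⟧ *_) (value-↭ [] (ordered-apart 0 w) (↭-sym t↭w)) ⟨
    ⟦ sgn t ⟧ * value (ordered 0 w)
      ≡⟨ cong₂ (λ s u → ⟦ sgn t ⟧ * (⟦ s ⟧ * f u)) (sgn-ordered 0 w) (forget-ordered 0 w) ⟩
    ⟦ sgn t ⟧ * (1ℚ * f w)                    ≡⟨ cong (⟦ sgn t ⟧ *_) (ℚ.*-identityˡ (f w)) ⟩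
    ⟦ sgn t ⟧ * f w                           ∎
    where open ≡-Reasoning

symmetric⇒adjacent : ∀ f → Symmetric f → Adjacent f
symmetric⇒adjacent f sy p c d q = trans (cong f (sym forget-t)) (trans (sy w t t↭w) (cong (λ s → ⟦ s ⟧ * f w) sgn-t))
  where
  w = p ++ d ∷ c ∷ q
  k = length p
  cell : ℕ → Cell → Maybe ℕ × ℕ
  cell j (true , α)  = just j , α
  cell j (false , α) = nothing , α
  ordered-∷ : ∀ j e r → ordered j (e ∷ r) ≡ cell j e ∷ ordered (suc j) r
  ordered-∷ j (true , _) r = refl
  ordered-∷ j (false , _) r = refl
  forget-cell : ∀ j e → forgetCell (cell j e) ≡ e
  forget-cell j (true , _) = refl
  forget-cell j (false , _) = refl
  d′ = cell k d
  c′ = cell (suc k) c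
  rest = ordered (suc (suc k)) q
  w-eq : ordered 0 w ≡ ordered 0 p ++ d′ ∷ c′ ∷ rest
  w-eq = trans (ordered-++ 0 p (d ∷ c ∷ q))
    (cong (ordered 0 p ++_) (trans (ordered-∷ k d _) (cong (d′ ∷_) (ordered-∷ (suc k) c q))))
  t = ordered 0 p ++ c′ ∷ d′ ∷ rest
  t↭w : t ↭ ordered 0 w
  t↭w = subst (t ↭_) (sym w-eq) (Perm.++⁺ˡ (ordered 0 p) (↭-swap c′ d′ ↭-refl))
  forget-t : forget t ≡ p ++ c ∷ d ∷ q
  forget-t = trans (List.map-++ forgetCell (ordered 0 p) _)
    (cong₂ _++_ (forget-ordered 0 p)
      (cong₂ _∷_ (forget-cell _ c) (cong₂ _∷_ (forget-cell _ d) (forget-ordered _ q))))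
  apart : ∀ c d → Apart (cell (suc k) c) (cell k d)
  apart (true , _) (true , _) _ refl eq = ℕ.1+n≢n (sym (just-injective eq))
  apart (true , _) (false , _) _ _ ()
  apart (false , _) _ _ ()
  sgn-t : sgn t ≡ swapSign c d
  sgn-t = trans (sgn-swap (ordered 0 p) c′ d′ rest (apart c d))
    (trans (cong₂ Sign._*_ (cong₂ swapSign (forget-cell _ c) (forget-cell _ d))
                           (trans (cong sgn (sym w-eq)) (sgn-ordered 0 w)))
           (Sign.*-identityʳ _))

degree-++ : ∀ u v → degree (u ++ v) ≡ degree u ℕ.+ degree v
degree-++ u v = trans (cong ℕ.sum (List.map-++ cellDegree u v)) (ℕ.sum-++ (map cellDegree u) _)

+-symmetric : ∀ f g → Symmetric f → Symmetric g → Symmetric (λ w → f w + g w)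
+-symmetric f g sf sg w t r =
  trans (cong₂ _+_ (sf w t r) (sg w t r)) (sym (ℚ.*-distribˡ-+ ⟦ sgn t ⟧ (f w) (g w)))

*ʳ-symmetric : ∀ q f → Symmetric f → Symmetric (λ w → f w * q)
*ʳ-symmetric q f sf w t r = trans (cong (_* q) (sf w t r)) (ℚ.*-assoc ⟦ sgn t ⟧ (f w) q)

*ˡ-symmetric : ∀ q f → Symmetric f → Symmetric (λ w → q * f w)
*ˡ-symmetric q f sf w t r = trans (ℚ.*-comm q _)
  (trans (*ʳ-symmetric q f sf w t r) (cong (⟦ sgn t ⟧ *_) (ℚ.*-comm (f w) q)))

0-symmetric : Symmetric (λ _ → 0ℚ)
0-symmetric w t r = sym (ℚ.*-zeroʳ ⟦ sgn t ⟧)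

0𝚲 : 𝚲
0𝚲 = record
  { coef = λ _ → 0ℚ ; stable = λ _ → refl ; symmetric = 0-symmetric ; bounded = 0 , λ _ _ → refl }

infixl 6 _+𝚲_
_+𝚲_ : 𝚲 → 𝚲 → 𝚲
f +𝚲 g = record
  { coef      = λ w → F.coef w + G.coef w
  ; stable    = λ w → cong₂ _+_ (F.stable w) (G.stable w)
  ; symmetric = +-symmetric F.coef G.coef F.symmetric G.symmetric
  ; bounded   = proj₁ F.bounded ℕ.+ proj₁ G.bounded , λ w lt →
      cong₂ _+_ (proj₂ F.bounded w (ℕ.≤-<-trans (ℕ.m≤m+n _ _) lt))
                (proj₂ G.bounded w (ℕ.≤-<-trans (ℕ.m≤n+m _ (proj₁ F.bounded)) lt))
  }
  where
  module F = 𝚲 f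
  module G = 𝚲 g

infixr 7 _·_
_·_ : ℚ → 𝚲 → 𝚲
q · f = record
  { coef      = λ w → q * F.coef w
  ; stable    = λ w → cong (q *_) (F.stable w)
  ; symmetric = *ˡ-symmetric q F.coef F.symmetric
  ; bounded   = proj₁ F.bounded , λ w lt → trans (cong (q *_) (proj₂ F.bounded w lt)) (ℚ.*-zeroʳ q)
  }
  where module F = 𝚲 f

∑𝚲 : ∀ {A : Set} → List A → (A → 𝚲) → 𝚲
∑𝚲 xs F = foldr (λ x s → F x +𝚲 s) 0𝚲 xs

1-coef : Mono → ℚ
1-coef w = if isOne w then 1ℚ else 0ℚ

isOne-∷ʳ : ∀ w → isOne (w ∷ʳ 𝟙) ≡ isOne w
isOne-∷ʳ [] = refl
isOne-∷ʳ ((false , zero) ∷ w) = isOne-∷ʳ w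
isOne-∷ʳ ((false , suc _) ∷ w) = refl
isOne-∷ʳ ((true , _) ∷ w) = refl

isOne⇒degree : ∀ w → isOne w ≡ true → degree w ≡ 0
isOne⇒degree [] _ = refl
isOne⇒degree ((false , zero) ∷ w) eq = isOne⇒degree w eq

1-adjacent : Adjacent 1-coef
1-adjacent ((false , zero) ∷ p) c d q = 1-adjacent p c d q
1-adjacent ((false , suc _) ∷ p) c d q = sym (ℚ.*-zeroʳ ⟦ swapSign c d ⟧)
1-adjacent ((true , _) ∷ p) c d q = sym (ℚ.*-zeroʳ ⟦ swapSign c d ⟧)
1-adjacent [] (false , zero) (false , zero) q = sym (ℚ.*-identityˡ _)
1-adjacent [] (false , zero) (false , suc _) q = refl
1-adjacent [] (false , suc _) (false , zero) q = refl
1-adjacent [] (false , suc _) (false , suc _) q = refl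
1-adjacent [] (false , zero) (true , _) q = refl
1-adjacent [] (false , suc _) (true , _) q = refl
1-adjacent [] (true , _) (false , zero) q = refl
1-adjacent [] (true , _) (false , suc _) q = refl
1-adjacent [] (true , _) (true , _) q = refl

1𝚲 : 𝚲
1𝚲 = record
  { coef      = 1-coef
  ; stable    = λ w → cong (if_then 1ℚ else 0ℚ) (isOne-∷ʳ w)
  ; symmetric = adjacent⇒symmetric 1-coef 1-adjacent
  ; bounded   = 0 , bound
  }
  where
  bound : ∀ w → 0 < degree w → 1-coef w ≡ 0ℚ
  bound w lt with isOne w in eq
  ... | false = refl
  ... | true  = contradiction lt (ℕ.<-irrefl (sym (isOne⇒degree w eq)))

0⊗ : 𝚲⊗𝚲
0⊗ = record
  { coef = λ _ _ → 0ℚ ; stableˣ = λ _ _ → refl ; stableʸ = λ _ _ → refl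
  ; symmetricˣ = λ _ → 0-symmetric ; symmetricʸ = λ _ → 0-symmetric ; bounded = 0 , λ _ _ _ → refl }

infixl 6 _⊕_
_⊕_ : 𝚲⊗𝚲 → 𝚲⊗𝚲 → 𝚲⊗𝚲
f ⊕ g = record
  { coef       = λ u v → F.coef u v + G.coef u v
  ; stableˣ    = λ u v → cong₂ _+_ (F.stableˣ u v) (G.stableˣ u v)
  ; stableʸ    = λ u v → cong₂ _+_ (F.stableʸ u v) (G.stableʸ u v)
  ; symmetricˣ = λ v → +-symmetric _ _ (F.symmetricˣ v) (G.symmetricˣ v)
  ; symmetricʸ = λ u → +-symmetric _ _ (F.symmetricʸ u) (G.symmetricʸ u)
  ; bounded    = proj₁ F.bounded ℕ.+ proj₁ G.bounded , λ u v lt →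
      cong₂ _+_ (proj₂ F.bounded u v (ℕ.≤-<-trans (ℕ.m≤m+n _ _) lt))
                (proj₂ G.bounded u v (ℕ.≤-<-trans (ℕ.m≤n+m _ (proj₁ F.bounded)) lt))
  }
  where
  module F = 𝚲⊗𝚲 f
  module G = 𝚲⊗𝚲 g

-- The sum over all pairs (k , ℓ) of natural numbers with k + ℓ = i.
∑⊗ : ℕ → (ℕ → ℕ → 𝚲⊗𝚲) → 𝚲⊗𝚲
∑⊗ i F = foldr (λ k s → F k (i ∸ k) ⊕ s) 0⊗ (upTo (suc i))

infix 5 ∑⊗
syntax ∑⊗ i (λ k ℓ → F) = ∑[ k + ℓ ≡ i ] F

-- All factorizations θ^ε x^α = ± (θ^ε′ x^α′) (θ^ε″ x^α″).
splitCell : Cell → List (Cell × Cell)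
splitCell (false , α) = map (λ k → (false , k) , (false , α ∸ k)) (upTo (suc α))
splitCell (true , α)  = map (λ k → (true , k) , (false , α ∸ k)) (upTo (suc α))
                     ++ map (λ k → (false , k) , (true , α ∸ k)) (upTo (suc α))

splits : Mono → List (List (Cell × Cell))
splits []      = [ [] ]
splits (c ∷ w) = cartesianProductWith _∷_ (splitCell c) (splits w)

θ-parity : Mono → Sign
θ-parity []              = Sign.+
θ-parity ((true , _) ∷ w)  = opposite (θ-parity w)
θ-parity ((false , _) ∷ w) = θ-parity w

-- The sign by which the product of the left monomial and the right
-- monomial of a factorization differs from the factorized monomial.
crossing : List (Cell × Cell) → Sign
crossing []                    = Sign.+
crossing ((_ , (true , _)) ∷ p)  = θ-parity (map proj₁ p) Sign.* crossing p
crossing ((_ , (false , _)) ∷ p) = crossing p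

-- The product of two power series in the variables (x;θ) and (y;φ),
-- given by their coefficients of u(x;θ) v(y;φ).
infixl 7 _⊛_
_⊛_ : (Mono → Mono → ℚ) → (Mono → Mono → ℚ) → (Mono → Mono → ℚ)
(F ⊛ G) u v = ∑ (cartesianProduct (splits u) (splits v)) λ (p , q) →
  ⟦ crossing (p ++ q) ⟧ * (F (map proj₁ p) (map proj₁ q) * G (map proj₂ p) (map proj₂ q))

-- f(x;θ) and f(y;φ).
inˣ inʸ : (Mono → ℚ) → (Mono → Mono → ℚ)
inˣ f u v = if isOne v then f u else 0ℚ
inʸ f u v = if isOne u then f v else 0ℚ

module Splits where

  splitCell-! : ∀ c → Unique (splitCell c)
  splitCell-! (false , α) = Unique.map⁺ (λ { refl → refl }) (Unique.upTo⁺ (suc α))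
  splitCell-! (true , α)  = Unique.++⁺
    (Unique.map⁺ (λ { refl → refl }) (Unique.upTo⁺ (suc α)))
    (Unique.map⁺ (λ { refl → refl }) (Unique.upTo⁺ (suc α)))
    disj
    where
    disj : ∀ {x} → ¬ (x ∈ map (λ k → (true , k) , (false , α ∸ k)) (upTo (suc α)) ×
                      x ∈ map (λ k → (false , k) , (true , α ∸ k)) (upTo (suc α)))
    disj (a , b) with ∈-map⁻ (λ k → (true , k) , (false , α ∸ k)) a | ∈-map⁻ (λ k → (false , k) , (true , α ∸ k)) b
    ... | _ , _ , refl | _ , _ , ()

  splits-! : ∀ w → Unique (splits w)
  splits-! []      = [] ∷ []
  splits-! (c ∷ w) = Unique.cartesianProductWith⁺ _∷_ List.∷-injective (splitCell-! c) (splits-! w)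

  split-left : ∀ c → (c , 𝟙) ∈ splitCell c
  split-left (false , α) = subst (λ z → ((false , α) , (false , z)) ∈ splitCell (false , α)) (ℕ.n∸n≡0 α)
    (∈-map⁺ _ (∈-upTo⁺ (ℕ.n<1+n α)))
  split-left (true , α) = subst (λ z → ((true , α) , (false , z)) ∈ splitCell (true , α)) (ℕ.n∸n≡0 α)
    (∈-++⁺ˡ (∈-map⁺ _ (∈-upTo⁺ (ℕ.n<1+n α))))

  split-right : ∀ c → (𝟙 , c) ∈ splitCell c
  split-right (false , α) = ∈-map⁺ _ (∈-upTo⁺ {n = suc α} (s≤s z≤n))
  split-right (true , α) = ∈-++⁺ʳ (map (λ k → (true , k) , (false , α ∸ k)) (upTo (suc α)))
    (∈-map⁺ _ (∈-upTo⁺ {n = suc α} (s≤s z≤n)))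

  lefts rights : Mono → List (Cell × Cell)
  lefts  = map (_, 𝟙)
  rights = map (𝟙 ,_)

  lefts-∈ : ∀ w → lefts w ∈ splits w
  lefts-∈ []      = here refl
  lefts-∈ (c ∷ w) = ∈-cartesianProductWith⁺ _∷_ (split-left c) (lefts-∈ w)

  rights-∈ : ∀ w → rights w ∈ splits w
  rights-∈ []      = here refl
  rights-∈ (c ∷ w) = ∈-cartesianProductWith⁺ _∷_ (split-right c) (rights-∈ w)

  split-left⁻ : ∀ {c d} → (d , 𝟙) ∈ splitCell c → d ≡ c
  split-left⁻ {false , α} m with ∈-map⁻ (λ k → (false , k) , (false , α ∸ k)) m
  ... | k , k∈ , eq with refl ← cong proj₁ eq =
    cong (false ,_) (ℕ.≤-antisym (ℕ.≤-pred (∈-upTo⁻ k∈)) (ℕ.m∸n≡0⇒m≤n (sym (cong (proj₂ ∘ proj₂) eq))))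
  split-left⁻ {true , α} m with ∈-++⁻ (map (λ k → (true , k) , (false , α ∸ k)) (upTo (suc α))) m
  ... | inj₁ m₁ with ∈-map⁻ (λ k → (true , k) , (false , α ∸ k)) m₁
  ...   | k , k∈ , eq with refl ← cong proj₁ eq =
    cong (true ,_) (ℕ.≤-antisym (ℕ.≤-pred (∈-upTo⁻ k∈)) (ℕ.m∸n≡0⇒m≤n (sym (cong (proj₂ ∘ proj₂) eq))))
  split-left⁻ {true , α} m | inj₂ m₂ with ∈-map⁻ (λ k → (false , k) , (true , α ∸ k)) m₂
  ...   | k , k∈ , ()

  split-right⁻ : ∀ {c d} → (𝟙 , d) ∈ splitCell c → d ≡ c
  split-right⁻ {false , α} m with ∈-map⁻ (λ k → (false , k) , (false , α ∸ k)) m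
  ... | zero , k∈ , refl = refl
  split-right⁻ {true , α} m with ∈-++⁻ (map (λ k → (true , k) , (false , α ∸ k)) (upTo (suc α))) m
  ... | inj₂ m₂ with ∈-map⁻ (λ k → (false , k) , (true , α ∸ k)) m₂
  ...   | zero , k∈ , refl = refl
  split-right⁻ {true , α} m | inj₁ m₁ with ∈-map⁻ (λ k → (true , k) , (false , α ∸ k)) m₁
  ...   | k , k∈ , ()

  isOne-∷ : ∀ c w → isOne (c ∷ w) ≡ true → c ≡ 𝟙 × isOne w ≡ true
  isOne-∷ (false , zero) w eq = refl , eq

  lefts-! : ∀ w {p} → p ∈ splits w → isOne (map proj₂ p) ≡ true → p ≡ lefts w
  lefts-! [] (here refl) _ = refl
  lefts-! (c ∷ w) m eq with ∈-cartesianProductWith⁻ _∷_ (splitCell c) (splits w) m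
  ... | (d , d′) , p , d∈ , p∈ , refl with isOne-∷ d′ (map proj₂ p) eq
  ...   | refl , eq′ = cong₂ _∷_ (cong (_, 𝟙) (split-left⁻ d∈)) (lefts-! w p∈ eq′)

  rights-! : ∀ w {p} → p ∈ splits w → isOne (map proj₁ p) ≡ true → p ≡ rights w
  rights-! [] (here refl) _ = refl
  rights-! (c ∷ w) m eq with ∈-cartesianProductWith⁻ _∷_ (splitCell c) (splits w) m
  ... | (d , d′) , p , d∈ , p∈ , refl with isOne-∷ d (map proj₁ p) eq
  ...   | refl , eq′ = cong₂ _∷_ (cong (𝟙 ,_) (split-right⁻ d∈)) (rights-! w p∈ eq′)

  isOne-lefts : ∀ w → isOne (map proj₂ (lefts w)) ≡ true
  isOne-lefts []      = refl
  isOne-lefts (_ ∷ w) = isOne-lefts w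

  isOne-rights : ∀ w → isOne (map proj₁ (rights w)) ≡ true
  isOne-rights []      = refl
  isOne-rights (_ ∷ w) = isOne-rights w

  lefts-proj₁ : ∀ w → map proj₁ (lefts w) ≡ w
  lefts-proj₁ []      = refl
  lefts-proj₁ (c ∷ w) = cong (c ∷_) (lefts-proj₁ w)

  rights-proj₂ : ∀ w → map proj₂ (rights w) ≡ w
  rights-proj₂ []      = refl
  rights-proj₂ (c ∷ w) = cong (c ∷_) (rights-proj₂ w)

  parity-rights : ∀ v → θ-parity (map proj₁ (rights v)) ≡ Sign.+
  parity-rights []      = refl
  parity-rights (_ ∷ v) = parity-rights v

  crossing-rights : ∀ v → crossing (rights v) ≡ Sign.+
  crossing-rights [] = refl
  crossing-rights ((true , _) ∷ v) = cong₂ Sign._*_ (parity-rights v) (crossing-rights v)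
  crossing-rights ((false , _) ∷ v) = crossing-rights v

  crossing-lefts-rights : ∀ u v → crossing (lefts u ++ rights v) ≡ Sign.+
  crossing-lefts-rights []      v = crossing-rights v
  crossing-lefts-rights (_ ∷ u) v = crossing-lefts-rights u v

open Splits

inˣ-⊛-inʸ : ∀ f g u v → (inˣ f ⊛ inʸ g) u v ≡ f u * g v
inˣ-⊛-inʸ f g u v =
  trans (∑-single φ (Unique.cartesianProduct⁺ (splits-! u) (splits-! v))
                    (∈-cartesianProduct⁺ (lefts-∈ u) (rights-∈ v)) vanish)
        value
  where
  φ : List (Cell × Cell) × List (Cell × Cell) → ℚ
  φ (p , q) = ⟦ crossing (p ++ q) ⟧ *
    (inˣ f (map proj₁ p) (map proj₁ q) * inʸ g (map proj₂ p) (map proj₂ q))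
  vanish : ∀ {y} → y ∈ cartesianProduct (splits u) (splits v) → y ≢ (lefts u , rights v) → φ y ≡ 0ℚ
  vanish {p , q} m ne with ∈-cartesianProduct⁻ (splits u) (splits v) m
  ... | p∈ , q∈ with isOne (map proj₁ q) in eq₁ | isOne (map proj₂ p) in eq₂
  ...   | true | true = ⊥-elim (ne (cong₂ _,_ (lefts-! u p∈ eq₂) (rights-! v q∈ eq₁)))
  ...   | false | b = trans (cong (c *_) (ℚ.*-zeroˡ (if b then g (map proj₂ q) else 0ℚ))) (ℚ.*-zeroʳ c)
    where c = ⟦ crossing (p ++ q) ⟧
  ...   | true | false = trans (cong (c *_) (ℚ.*-zeroʳ (f (map proj₁ p)))) (ℚ.*-zeroʳ c)
    where c = ⟦ crossing (p ++ q) ⟧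
  value : φ (lefts u , rights v) ≡ f u * g v
  value rewrite isOne-rights v | isOne-lefts u | lefts-proj₁ u | rights-proj₂ v
              | crossing-lefts-rights u v = ℚ.*-identityˡ _

infixr 8 _⊗_
_⊗_ : 𝚲 → 𝚲 → 𝚲⊗𝚲
f ⊗ g = record
  { coef       = FG
  ; stableˣ    = λ u v → via (u ∷ʳ 𝟙) v u v (cong (_* G.coef v) (F.stable u))
  ; stableʸ    = λ u v → via u (v ∷ʳ 𝟙) u v (cong (F.coef u *_) (G.stable v))
  ; symmetricˣ = λ v w t r → trans (inˣ-⊛-inʸ F.coef G.coef (forget t) v)
      (trans (*ʳ-symmetric (G.coef v) F.coef F.symmetric w t r)
             (cong (⟦ sgn t ⟧ *_) (sym (inˣ-⊛-inʸ F.coef G.coef w v))))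
  ; symmetricʸ = λ u w t r → trans (inˣ-⊛-inʸ F.coef G.coef u (forget t))
      (trans (*ˡ-symmetric (F.coef u) G.coef G.symmetric w t r)
             (cong (⟦ sgn t ⟧ *_) (sym (inˣ-⊛-inʸ F.coef G.coef u w))))
  ; bounded    = proj₁ F.bounded ℕ.+ proj₁ G.bounded , bound
  }
  where
  module F = 𝚲 f
  module G = 𝚲 g
  FG : Mono → Mono → ℚ
  FG = inˣ F.coef ⊛ inʸ G.coef
  via : ∀ u v u′ v′ → F.coef u * G.coef v ≡ F.coef u′ * G.coef v′ → FG u v ≡ FG u′ v′
  via u v u′ v′ eq = trans (inˣ-⊛-inʸ F.coef G.coef u v) (trans eq (sym (inˣ-⊛-inʸ F.coef G.coef u′ v′)))
  bound : ∀ u v → proj₁ F.bounded ℕ.+ proj₁ G.bounded < degree u ℕ.+ degree v → FG u v ≡ 0ℚ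
  bound u v lt with proj₁ F.bounded ℕ.<? degree u | proj₁ G.bounded ℕ.<? degree v
  ... | yes a | _ = trans (inˣ-⊛-inʸ F.coef G.coef u v)
        (trans (cong (_* G.coef v) (proj₂ F.bounded u a)) (ℚ.*-zeroˡ (G.coef v)))
  ... | no _ | yes b = trans (inˣ-⊛-inʸ F.coef G.coef u v)
        (trans (cong (F.coef u *_) (proj₂ G.bounded v b)) (ℚ.*-zeroʳ (F.coef u)))
  ... | no a | no b = ⊥-elim (ℕ.<⇒≱ lt (ℕ.+-mono-≤ (ℕ.≮⇒≥ a) (ℕ.≮⇒≥ b)))

-- The coefficient of u(x₁,…,x_M;θ) v(y₁,…,y_N;φ) in f(x,y;θ,φ) is the
-- coefficient of u v in f(z₁,…,z_{M+N}) with z = (x₁,…,x_M,y₁,…,y_N).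
Δ : 𝚲 → 𝚲⊗𝚲
Δ f = record
  { coef       = λ u v → F.coef (u ++ v)
  ; stableˣ    = λ u v → trans (cong F.coef (List.∷ʳ-++ u 𝟙 v)) (drop-𝟙 u v)
  ; stableʸ    = λ u v → trans (cong F.coef (sym (List.++-assoc u v [ 𝟙 ]))) (F.stable (u ++ v))
  ; symmetricˣ = λ v → adjacent⇒symmetric _ λ p c d q →
      subst₂ (λ a b → F.coef a ≡ ⟦ swapSign c d ⟧ * F.coef b)
        (sym (List.++-assoc p (c ∷ d ∷ q) v)) (sym (List.++-assoc p (d ∷ c ∷ q) v))
        (adj p c d (q ++ v))
  ; symmetricʸ = λ u → adjacent⇒symmetric _ λ p c d q →
      subst₂ (λ a b → F.coef a ≡ ⟦ swapSign c d ⟧ * F.coef b)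
        (List.++-assoc u p (c ∷ d ∷ q)) (List.++-assoc u p (d ∷ c ∷ q))
        (adj (u ++ p) c d q)
  ; bounded    = proj₁ F.bounded , λ u v lt →
      proj₂ F.bounded (u ++ v) (subst (proj₁ F.bounded <_) (sym (degree-++ u v)) lt)
  }
  where
  module F = 𝚲 f
  adj = symmetric⇒adjacent F.coef F.symmetric
  drop-𝟙 : ∀ u v → F.coef (u ++ 𝟙 ∷ v) ≡ F.coef (u ++ v)
  drop-𝟙 u []      = trans (F.stable u) (cong F.coef (sym (List.++-identityʳ u)))
  drop-𝟙 u (c ∷ v) = trans (adj u 𝟙 c v) (trans (ℚ.*-identityˡ _)
    (trans (cong F.coef (sym (List.∷ʳ-++ u c (𝟙 ∷ v))))
      (trans (drop-𝟙 (u ∷ʳ c) v) (cong F.coef (List.∷ʳ-++ u c v)))))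

record IsSuperpartition (n m : ℕ) (Λ : Vec ℕ m × List ℕ) : Set where
  constructor isSuperpartition
  field
    strict    : VecLinked.Linked _>_ (proj₁ Λ)
    partition : Linked _≥_ (proj₂ Λ)
    positive  : All (1 ≤_) (proj₂ Λ)
    size      : Vec.sum (proj₁ Λ) ℕ.+ ℕ.sum (proj₂ Λ) ≡ n

-- Superpartitions (Λᵃ ; Λˢ) of type (n|m), with the trailing zeros of Λˢ
-- removed.
record Superpartition (n m : ℕ) : Set where
  constructor superpartition
  field
    parts : Vec ℕ m × List ℕ
    valid : IsSuperpartition n m parts
  Λᵃ : Vec ℕ m
  Λᵃ = proj₁ parts
  Λˢ : List ℕ
  Λˢ = proj₂ parts
  open IsSuperpartition valid public

open Superpartition using (parts)

isSuperpartition? : ∀ n m Λ → Dec (IsSuperpartition n m Λ)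
isSuperpartition? n m (a , s) =
  map′ (λ (p , q , r , e) → isSuperpartition p q r e)
       (λ (isSuperpartition p q r e) → p , q , r , e)
       (VecLinked.linked? ℕ._>?_ a ×-dec Linked.linked? ℕ._≥?_ s
         ×-dec All.all? (1 ℕ.≤?_) s ×-dec (Vec.sum a ℕ.+ ℕ.sum s ℕ.≟ n))

-- All vectors of length m, and all lists of length at most L, with entries
-- at most b.
boundedVecs : (m b : ℕ) → List (Vec ℕ m)
boundedVecs zero    b = [ [] ]
boundedVecs (suc m) b = cartesianProductWith _∷_ (upTo (suc b)) (boundedVecs m b)

boundedLists : (L b : ℕ) → List (List ℕ)
boundedLists zero    b = [ [] ]
boundedLists (suc L) b = [] ∷ cartesianProductWith _∷_ (upTo (suc b)) (boundedLists L b)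

candidates : (n m : ℕ) → List (Vec ℕ m × List ℕ)
candidates n m = cartesianProduct (boundedVecs m n) (boundedLists n n)

superpartitions : (n m : ℕ) → List (Superpartition n m)
superpartitions n m =
  map (λ (Λ , p) → superpartition Λ p) (All.toList (All.all-filter (isSuperpartition? n m) (candidates n m)))

module Enumeration where

  parts-toList : ∀ {n m} {xs} (ps : All (IsSuperpartition n m) xs) →
                 map parts (map (λ (Λ , p) → superpartition Λ p) (All.toList ps)) ≡ xs
  parts-toList []       = refl
  parts-toList (p ∷ ps) = cong (_ ∷_) (parts-toList ps)

  boundedVecs-! : ∀ m b → Unique (boundedVecs m b)
  boundedVecs-! zero    b = [] ∷ []
  boundedVecs-! (suc m) b =
    Unique.cartesianProductWith⁺ _∷_ Vec.∷-injective (Unique.upTo⁺ (suc b)) (boundedVecs-! m b)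

  boundedLists-! : ∀ L b → Unique (boundedLists L b)
  boundedLists-! zero    b = [] ∷ []
  boundedLists-! (suc L) b =
    All.tabulate nonempty ∷
    Unique.cartesianProductWith⁺ _∷_ List.∷-injective (Unique.upTo⁺ (suc b)) (boundedLists-! L b)
    where
    nonempty : ∀ {x} → x ∈ cartesianProductWith _∷_ (upTo (suc b)) (boundedLists L b) → [] ≢ x
    nonempty m refl with ∈-cartesianProductWith⁻ _∷_ (upTo (suc b)) (boundedLists L b) m
    ... | _ , _ , _ , _ , ()

  boundedVecs-∈ : ∀ {m} b (a : Vec ℕ m) → Vec.sum a ≤ b → a ∈ boundedVecs m b
  boundedVecs-∈ b []      _  = here refl
  boundedVecs-∈ b (x ∷ a) le = ∈-cartesianProductWith⁺ _∷_
    (∈-upTo⁺ (s≤s (ℕ.≤-trans (ℕ.m≤m+n x _) le)))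
    (boundedVecs-∈ b a (ℕ.≤-trans (ℕ.m≤n+m _ x) le))

  boundedLists-∈ : ∀ L b s → All (1 ≤_) s → ℕ.sum s ≤ L → ℕ.sum s ≤ b → s ∈ boundedLists L b
  boundedLists-∈ zero    b []      _ _ _ = here refl
  boundedLists-∈ (suc L) b []      _ _ _ = here refl
  boundedLists-∈ zero    b (x ∷ s) (1≤x ∷ _) le _ =
    ⊥-elim (ℕ.<⇒≱ 1≤x (ℕ.≤-trans (ℕ.m≤m+n x _) le))
  boundedLists-∈ (suc L) b (x ∷ s) (1≤x ∷ ps) leL leb = there (∈-cartesianProductWith⁺ _∷_
    (∈-upTo⁺ (s≤s (ℕ.≤-trans (ℕ.m≤m+n x _) leb)))
    (boundedLists-∈ L b s ps
      (ℕ.≤-pred (ℕ.≤-trans (ℕ.+-monoˡ-≤ (ℕ.sum s) 1≤x) leL))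
      (ℕ.≤-trans (ℕ.m≤n+m _ x) leb)))

  superpartitions-unique : ∀ n m → Unique (map parts (superpartitions n m))
  superpartitions-unique n m =
    subst Unique (sym (parts-toList (All.all-filter (isSuperpartition? n m) (candidates n m))))
      (Unique.filter⁺ (isSuperpartition? n m)
        (Unique.cartesianProduct⁺ (boundedVecs-! m n) (boundedLists-! n n)))

  superpartitions-complete : ∀ {n m} (Λ : Superpartition n m) → parts Λ ∈ map parts (superpartitions n m)
  superpartitions-complete {n} {m} Λ =
    subst (parts Λ ∈_) (sym (parts-toList (All.all-filter (isSuperpartition? n m) (candidates n m))))
      (∈-filter⁺ (isSuperpartition? n m)
        (∈-cartesianProduct⁺ (boundedVecs-∈ n Λᵃ (ℕ.≤-trans (ℕ.m≤m+n _ _) (ℕ.≤-reflexive size)))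
                             (boundedLists-∈ n n Λˢ positive le le))
        (Superpartition.valid Λ))
    where
    open Superpartition Λ
    le : ℕ.sum Λˢ ≤ n
    le = ℕ.≤-trans (ℕ.m≤n+m _ (Vec.sum Λᵃ)) (ℕ.≤-reflexive size)

insertions : ∀ {A : Set} → A → List A → List (List A)
insertions x []       = [ [ x ] ]
insertions x (y ∷ ys) = (x ∷ y ∷ ys) ∷ map (y ∷_) (insertions x ys)

permutations : ∀ {A : Set} → List A → List (List A)
permutations []       = [ [] ]
permutations (x ∷ xs) = concatMap (insertions x) (permutations xs)

fermionic : ∀ {m} → ℕ → Vec ℕ m → Term
fermionic k []      = []
fermionic k (a ∷ as) = (just k , a) ∷ fermionic (suc k) as

bosonic : List ℕ → Term
bosonic = map (nothing ,_)

-- θ₁⋯θₘ x₁^Λ₁ ⋯ x_N^Λ_N, if N is at least the number of parts of Λ.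
leading : ∀ {n m} → Superpartition n m → ℕ → Term
leading {m = m} Λ N = fermionic 0 Λᵃ ++ bosonic (Λˢ ++ replicate (N ∸ (m ℕ.+ length Λˢ)) 0)
  where open Superpartition Λ

-- The distinct terms among θ_{σ(1)}⋯θ_{σ(m)} x_{σ(1)}^Λ₁ ⋯ x_{σ(N)}^Λ_N,
-- σ ∈ S_N, each in the form sign × monomial.
distinctTerms : ∀ {n m} → Superpartition n m → ℕ → List (Sign × Mono)
distinctTerms Λ N =
  deduplicate (Product.≡-dec Sign._≟_ _≟ᵐ_) (map (λ t → sgn t , forget t) (permutations (leading Λ N)))

coefficientOf : Mono → Sign × Mono → ℚ
coefficientOf w (s , v) = if does (v ≟ᵐ w) then ⟦ s ⟧ else 0ℚ

-- The coefficient of a monomial in N variables is taken in m_Λ restricted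
-- to N variables.  If N is smaller than the number of parts of Λ, then
-- leading Λ N has length greater than N and the coefficient is 0.
m-coef : ∀ {n m} → Superpartition n m → Mono → ℚ
m-coef Λ w = ∑ (distinctTerms Λ (length w)) (coefficientOf w)

module Monomial where

  insertions-↭ : ∀ {A : Set} (x : A) ys {zs} → zs ∈ insertions x ys → zs ↭ x ∷ ys
  insertions-↭ x []       (here refl) = ↭-refl
  insertions-↭ x (y ∷ ys) (here refl) = ↭-refl
  insertions-↭ x (y ∷ ys) (there m) with ∈-map⁻ (y ∷_) m
  ... | _ , m′ , refl = ↭-trans (↭-prep y (insertions-↭ x ys m′)) (↭-swap y x ↭-refl)

  ∈-insertions : ∀ {A : Set} (x : A) as bs → as ++ x ∷ bs ∈ insertions x (as ++ bs)
  ∈-insertions x []       []       = here refl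
  ∈-insertions x []       (b ∷ bs) = here refl
  ∈-insertions x (a ∷ as) bs       = there (∈-map⁺ (a ∷_) (∈-insertions x as bs))

  permutations-↭ : ∀ {A : Set} (xs : List A) {zs} → zs ∈ permutations xs → zs ↭ xs
  permutations-↭ []       (here refl) = ↭-refl
  permutations-↭ (x ∷ xs) m with ∈-concat⁻′ (map (insertions x) (permutations xs)) m
  ... | _ , m₁ , m₂ with ∈-map⁻ (insertions x) m₂
  ...   | ys , m₃ , refl = ↭-trans (insertions-↭ x ys m₁) (↭-prep x (permutations-↭ xs m₃))

  ∈-permutations : ∀ {A : Set} (xs : List A) {zs} → zs ↭ xs → zs ∈ permutations xs
  ∈-permutations []       r = here (Perm.↭-empty-inv r)
  ∈-permutations (x ∷ xs) r with ∈-∃++ (Perm.∈-resp-↭ (↭-sym r) (here refl))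
  ... | as , bs , refl = ∈-concat⁺′ (∈-insertions x as bs)
    (∈-map⁺ (insertions x) (∈-permutations xs (Perm.drop-mid as [] r)))

  IsTerm : ∀ {n m} → Superpartition n m → ℕ → Sign → Mono → Set
  IsTerm Λ N s w = ∃[ t ] t ↭ leading Λ N × sgn t ≡ s × forget t ≡ w

  _≟ᵗ_ : DecidableEquality (Sign × Mono)
  _≟ᵗ_ = Product.≡-dec Sign._≟_ _≟ᵐ_

  open import Data.List.Membership.DecPropositional _≟ᵗ_ using (_∈?_)

  ∈⇒IsTerm : ∀ {n m} (Λ : Superpartition n m) N {s w} → (s , w) ∈ distinctTerms Λ N → IsTerm Λ N s w
  ∈⇒IsTerm Λ N i with ∈-map⁻ (λ t → sgn t , forget t) (∈-deduplicate⁻ _≟ᵗ_ _ i)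
  ... | t , j , refl = t , permutations-↭ (leading Λ N) j , refl , refl

  IsTerm⇒∈ : ∀ {n m} (Λ : Superpartition n m) N {s w} → IsTerm Λ N s w → (s , w) ∈ distinctTerms Λ N
  IsTerm⇒∈ Λ N (t , r , refl , refl) =
    ∈-deduplicate⁺ _≟ᵗ_ (∈-map⁺ (λ t → sgn t , forget t) (∈-permutations (leading Λ N) r))

  ind : ∀ {P : Set} → Dec P → ℚ
  ind p? = if does p? then 1ℚ else 0ℚ

  ind-cong : ∀ {P Q : Set} (p? : Dec P) (q? : Dec Q) → (P → Q) → (Q → P) → ind p? ≡ ind q?
  ind-cong (yes _) (yes _) _ _ = refl
  ind-cong (no _)  (no _)  _ _ = refl
  ind-cong (yes p) (no ¬q) f _ = ⊥-elim (¬q (f p))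
  ind-cong (no ¬p) (yes q) _ g = ⊥-elim (¬p (g q))

  ind-yes : ∀ {P : Set} (p? : Dec P) → P → ind p? ≡ 1ℚ
  ind-yes p? p rewrite dec-true p? p = refl

  ind-no : ∀ {P : Set} (p? : Dec P) → ¬ P → ind p? ≡ 0ℚ
  ind-no p? ¬p rewrite dec-false p? ¬p = refl

  ∑-ind : ∀ x D → Unique D → ∑ D (λ y → ind (y ≟ᵗ x)) ≡ ind (x ∈? D)
  ∑-ind x D uq = case (x ∈? D)
    where
    case : (d : Dec (x ∈ D)) → ∑ D (λ y → ind (y ≟ᵗ x)) ≡ ind d
    case (yes x∈) = trans (∑-single (λ y → ind (y ≟ᵗ x)) uq x∈ (λ {y} _ ne → ind-no (y ≟ᵗ x) ne))
                          (ind-yes (x ≟ᵗ x) refl)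
    case (no x∉) = ∑-zero D (λ {y} y∈ → ind-no (y ≟ᵗ x) (λ eq → x∉ (subst (_∈ D) eq y∈)))

  ∑-minus : ∀ {A : Set} (D : List A) (φ ψ : A → ℚ) → ∑ D (λ y → φ y - ψ y) ≡ ∑ D φ - ∑ D ψ
  ∑-minus []      φ ψ = refl
  ∑-minus (x ∷ D) φ ψ = begin
    (a - b) + ∑ D (λ y → φ y - ψ y)  ≡⟨ cong ((a - b) +_) (∑-minus D φ ψ) ⟩
    (a - b) + (c - d)                ≡⟨ ℚ.+-assoc a (- b) (c - d) ⟩
    a + (- b + (c - d))              ≡⟨ cong (a +_) (ℚ.+-assoc (- b) c (- d)) ⟨
    a + ((- b + c) - d)              ≡⟨ cong (λ z → a + (z - d)) (ℚ.+-comm (- b) c) ⟩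
    a + ((c - b) - d)                ≡⟨ cong (a +_) (ℚ.+-assoc c (- b) (- d)) ⟩
    a + (c + (- b - d))              ≡⟨ ℚ.+-assoc a c (- b - d) ⟨
    (a + c) + (- b - d)              ≡⟨ cong ((a + c) +_) (ℚ.neg-distrib-+ b d) ⟨
    (a + c) - (b + d)                ∎
    where
    open ≡-Reasoning
    a = φ x
    b = ψ x
    c = ∑ D φ
    d = ∑ D ψ

  coefficientOf-ind : ∀ w y → coefficientOf w y ≡ ind (y ≟ᵗ (Sign.+ , w)) - ind (y ≟ᵗ (Sign.- , w))
  coefficientOf-ind w (s , v) = go s (v ≟ᵐ w)
    where
    go : ∀ s (d : Dec (v ≡ w)) → (if does d then ⟦ s ⟧ else 0ℚ) ≡
         ind ((s , v) ≟ᵗ (Sign.+ , w)) - ind ((s , v) ≟ᵗ (Sign.- , w))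
    go Sign.+ (yes eq) = sym (cong₂ _-_ (ind-yes ((Sign.+ , v) ≟ᵗ (Sign.+ , w)) (cong (Sign.+ ,_) eq))
                                        (ind-no ((Sign.+ , v) ≟ᵗ (Sign.- , w)) λ ()))
    go Sign.- (yes eq) = sym (cong₂ _-_ (ind-no ((Sign.- , v) ≟ᵗ (Sign.+ , w)) λ ())
                                        (ind-yes ((Sign.- , v) ≟ᵗ (Sign.- , w)) (cong (Sign.- ,_) eq)))
    go s (no v≢w) = sym (cong₂ _-_ (ind-no ((s , v) ≟ᵗ (Sign.+ , w)) (v≢w ∘ cong proj₂))
                                   (ind-no ((s , v) ≟ᵗ (Sign.- , w)) (v≢w ∘ cong proj₂)))

  ∑-cong : ∀ {A : Set} (D : List A) {φ ψ : A → ℚ} → (∀ y → φ y ≡ ψ y) → ∑ D φ ≡ ∑ D ψ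
  ∑-cong []      h = refl
  ∑-cong (x ∷ D) h = cong₂ _+_ (h x) (∑-cong D h)

  term? : ∀ {n m} (Λ : Superpartition n m) N s w → Dec (IsTerm Λ N s w)
  term? Λ N s w = map′ (∈⇒IsTerm Λ N) (IsTerm⇒∈ Λ N) ((s , w) ∈? distinctTerms Λ N)

  m-coef-ind : ∀ {n m} (Λ : Superpartition n m) w →
    m-coef Λ w ≡ ind (term? Λ (length w) Sign.+ w) - ind (term? Λ (length w) Sign.- w)
  m-coef-ind Λ w = trans (∑-cong D (coefficientOf-ind w)) (trans (∑-minus D (λ y → ind (y ≟ᵗ (Sign.+ , w))) (λ y → ind (y ≟ᵗ (Sign.- , w))))
    (cong₂ _-_ (∑-ind (Sign.+ , w) D uq) (∑-ind (Sign.- , w) D uq)))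
    where
    D = distinctTerms Λ (length w)
    uq : Unique D
    uq = DecUnique.deduplicate-! _≟ᵗ_ _

  transfer : ∀ {n m} (Λ : Superpartition n m) σ w w′ →
    (∀ s → IsTerm Λ (length w) s w → IsTerm Λ (length w′) (σ Sign.* s) w′) →
    (∀ s → IsTerm Λ (length w′) s w′ → IsTerm Λ (length w) (σ Sign.* s) w) →
    m-coef Λ w ≡ ⟦ σ ⟧ * m-coef Λ w′
  transfer Λ σ w w′ f g = trans (m-coef-ind Λ w) (trans (go σ f g) (cong (⟦ σ ⟧ *_) (sym (m-coef-ind Λ w′))))
    where
    i j : Sign → ℚ
    i s = ind (term? Λ (length w) s w)
    j s = ind (term? Λ (length w′) s w′)
    go : ∀ σ → (∀ s → IsTerm Λ (length w) s w → IsTerm Λ (length w′) (σ Sign.* s) w′) →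
               (∀ s → IsTerm Λ (length w′) s w′ → IsTerm Λ (length w) (σ Sign.* s) w) →
         i Sign.+ - i Sign.- ≡ ⟦ σ ⟧ * (j Sign.+ - j Sign.-)
    go Sign.+ f g = trans
      (cong₂ _-_ (ind-cong (term? Λ _ Sign.+ w) (term? Λ _ Sign.+ w′) (f Sign.+) (g Sign.+))
                 (ind-cong (term? Λ _ Sign.- w) (term? Λ _ Sign.- w′) (f Sign.-) (g Sign.-)))
      (sym (ℚ.*-identityˡ (j Sign.+ - j Sign.-)))
    go Sign.- f g = trans
      (cong₂ _-_ (ind-cong (term? Λ _ Sign.+ w) (term? Λ _ Sign.- w′) (f Sign.+) (g Sign.-))
                 (ind-cong (term? Λ _ Sign.- w) (term? Λ _ Sign.+ w′) (f Sign.-) (g Sign.+)))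
      (flip (j Sign.+) (j Sign.-))
      where
      flip : ∀ a b → b - a ≡ - 1ℚ * (a - b)
      flip a b = begin
        b - a              ≡⟨ ℚ.+-comm b (- a) ⟩
        - a + b            ≡⟨ cong (- a +_) (⁻¹-involutive b) ⟨
        - a - (- b)        ≡⟨ ℚ.neg-distrib-+ a (- b) ⟨
        - (a - b)          ≡⟨ cong -_ (ℚ.*-identityˡ (a - b)) ⟨
        - (1ℚ * (a - b))   ≡⟨ ℚ.neg-distribˡ-* 1ℚ (a - b) ⟩
        - 1ℚ * (a - b)     ∎
        where open ≡-Reasoning

  map-++⁻ : ∀ {A B : Set} (f : A → B) ts p {q} → map f ts ≡ p ++ q →
            ∃[ t₁ ] ∃[ t₂ ] ts ≡ t₁ ++ t₂ × map f t₁ ≡ p × map f t₂ ≡ q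
  map-++⁻ f ts []      eq = [] , ts , refl , refl , eq
  map-++⁻ f (t ∷ ts) (c ∷ p) eq with List.∷-injective eq
  ... | refl , eq′ with map-++⁻ f ts p eq′
  ...   | t₁ , t₂ , refl , refl , refl = t ∷ t₁ , t₂ , refl , refl , refl

  bosonic-apart : ∀ s → AllPairs Apart (bosonic s)
  bosonic-apart []      = []
  bosonic-apart (_ ∷ s) = All.universal (λ _ _ ()) _ ∷ bosonic-apart s

  leading-apart : ∀ {m} k (a : Vec ℕ m) s → AllPairs Apart (fermionic k a ++ bosonic s)
  leading-apart k []      s = bosonic-apart s
  leading-apart k (x ∷ a) s = labels (suc k) ℕ.≤-refl a ∷ leading-apart (suc k) a s
    where
    labels : ∀ {m} j → k < j → (a : Vec ℕ m) → All (Apart (just k , x)) (fermionic j a ++ bosonic s)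
    labels j k<j []      = All.map⁺ (All.universal (λ _ _ _ ()) s)
    labels j k<j (_ ∷ a) = (λ { _ refl refl → ℕ.<-irrefl refl k<j }) ∷ labels (suc j) (ℕ.m<n⇒m<1+n k<j) a

  apart-at : ∀ p {c d q} → AllPairs Apart (p ++ c ∷ d ∷ q) → Apart c d
  apart-at []      ((ap ∷ _) ∷ _) = ap
  apart-at (_ ∷ p) (_ ∷ aps)      = apart-at p aps

  m-adjacent : ∀ {n m} (Λ : Superpartition n m) → Adjacent (m-coef Λ)
  m-adjacent Λ p c d q = transfer Λ (swapSign c d) (p ++ c ∷ d ∷ q) (p ++ d ∷ c ∷ q)
    (exchange p c d q)
    (λ s it → subst (λ σ → IsTerm Λ (length (p ++ c ∷ d ∷ q)) (σ Sign.* s) (p ++ c ∷ d ∷ q)) (swapSign-comm d c) (exchange p d c q s it))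
    where
    swapSign-comm : ∀ c d → swapSign c d ≡ swapSign d c
    swapSign-comm (true , _) (true , _) = refl
    swapSign-comm (true , _) (false , _) = refl
    swapSign-comm (false , _) (true , _) = refl
    swapSign-comm (false , _) (false , _) = refl
    exchange : ∀ p c d q s → IsTerm Λ (length (p ++ c ∷ d ∷ q)) s (p ++ c ∷ d ∷ q) →
               IsTerm Λ (length (p ++ d ∷ c ∷ q)) (swapSign c d Sign.* s) (p ++ d ∷ c ∷ q)
    exchange p c d q s (t , r , refl , eq) with map-++⁻ forgetCell t p eq
    ... | t₁ , c′ ∷ d′ ∷ t₂ , refl , refl , refl =
      t₁ ++ d′ ∷ c′ ∷ t₂ ,
      ↭-trans (Perm.++⁺ˡ t₁ (↭-swap d′ c′ ↭-refl)) (subst (λ N → (t₁ ++ c′ ∷ d′ ∷ t₂) ↭ leading Λ N) len r) ,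
      trans (sgn-swap t₁ d′ c′ t₂ (Apart-sym c′ d′ (apart-at t₁ (Apart-↭ (↭-sym r) (leading-apart 0 (Superpartition.Λᵃ Λ) _)))))
            (cong (Sign._* sgn (t₁ ++ c′ ∷ d′ ∷ t₂)) (swapSign-comm (forgetCell d′) (forgetCell c′))) ,
      List.map-++ forgetCell t₁ (d′ ∷ c′ ∷ t₂)
      where
      len : length (forget t₁ ++ c ∷ d ∷ q) ≡ length (forget t₁ ++ d ∷ c ∷ q)
      len = trans (List.length-++ (forget t₁)) (sym (List.length-++ (forget t₁)))

  length-fermionic : ∀ {m} k (a : Vec ℕ m) → length (fermionic k a) ≡ m
  length-fermionic k []      = refl
  length-fermionic k (_ ∷ a) = cong suc (length-fermionic (suc k) a)

  replicate-∷ʳ : ∀ j → replicate (suc j) 0 ≡ replicate j 0 ∷ʳ 0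
  replicate-∷ʳ zero    = refl
  replicate-∷ʳ (suc j) = cong (0 ∷_) (replicate-∷ʳ j)

  module _ {n m} (Λ : Superpartition n m) where
    open Superpartition Λ

    ℓ : ℕ
    ℓ = m ℕ.+ length Λˢ

    length-leading : ∀ N → length (leading Λ N) ≡ ℓ ℕ.+ (N ∸ ℓ)
    length-leading N = begin
      length (fermionic 0 Λᵃ ++ bosonic (Λˢ ++ z))          ≡⟨ List.length-++ (fermionic 0 Λᵃ) ⟩
      length (fermionic 0 Λᵃ) ℕ.+ length (bosonic (Λˢ ++ z))
        ≡⟨ cong₂ ℕ._+_ (length-fermionic 0 Λᵃ) (trans (List.length-map _ (Λˢ ++ z)) (List.length-++ Λˢ)) ⟩
      m ℕ.+ (length Λˢ ℕ.+ length z)                        ≡⟨ ℕ.+-assoc m _ _ ⟨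
      ℓ ℕ.+ length z                                        ≡⟨ cong (ℓ ℕ.+_) (List.length-replicate (N ∸ ℓ)) ⟩
      ℓ ℕ.+ (N ∸ ℓ)                                         ∎
      where
      open ≡-Reasoning
      z = replicate (N ∸ ℓ) 0

    leading-suc : ∀ {N} → ℓ ≤ N → leading Λ (suc N) ≡ leading Λ N ∷ʳ (nothing , 0)
    leading-suc {N} ℓ≤N rewrite ℕ.+-∸-assoc 1 ℓ≤N | replicate-∷ʳ (N ∸ ℓ)
      | sym (List.++-assoc Λˢ (replicate (N ∸ ℓ) 0) [ 0 ])
      | List.map-++ {B = Maybe ℕ × ℕ} (nothing ,_) (Λˢ ++ replicate (N ∸ ℓ) 0) [ 0 ] =
      sym (List.++-assoc (fermionic 0 Λᵃ) _ _)

    sgn-∷ʳ : ∀ t α → sgn (t ∷ʳ (nothing , α)) ≡ sgn t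
    sgn-∷ʳ [] α = refl
    sgn-∷ʳ ((nothing , _) ∷ t) α = sgn-∷ʳ t α
    sgn-∷ʳ ((just k , _) ∷ t) α = cong₂ Sign._*_ (smaller-∷ʳ t) (sgn-∷ʳ t α)
      where
      smaller-∷ʳ : ∀ t → smaller k (t ∷ʳ (nothing , α)) ≡ smaller k t
      smaller-∷ʳ [] = refl
      smaller-∷ʳ ((nothing , _) ∷ t) = smaller-∷ʳ t
      smaller-∷ʳ ((just l , _) ∷ t) = cong (inversion l k Sign.*_) (smaller-∷ʳ t)

    length-IsTerm : ∀ {N s w} → IsTerm Λ N s w → length w ≡ ℓ ℕ.+ (N ∸ ℓ)
    length-IsTerm {N} (t , r , _ , refl) =
      trans (List.length-map forgetCell t) (trans (Perm.↭-length r) (length-leading N))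

    no-zero : ∀ {N} → N ≤ ℓ → (nothing , 0) ∉ leading Λ N
    no-zero {N} N≤ℓ i rewrite ℕ.m≤n⇒m∸n≡0 N≤ℓ | List.++-identityʳ Λˢ with ∈-++⁻ (fermionic 0 Λᵃ) i
    ... | inj₁ j = fermion 0 Λᵃ j
      where
      fermion : ∀ {m} k (a : Vec ℕ m) → (nothing , 0) ∉ fermionic k a
      fermion k (_ ∷ a) (there j) = fermion (suc k) a j
    ... | inj₂ j with ∈-map⁻ {B = Maybe ℕ × ℕ} (nothing ,_) j
    ...   | _ , x∈ , refl = ℕ.1+n≰n (All.lookup positive x∈)

    m-stable : ∀ w → m-coef Λ (w ∷ʳ 𝟙) ≡ m-coef Λ w
    m-stable w = trans (transfer Λ Sign.+ (w ∷ʳ 𝟙) w shrink grow) (ℚ.*-identityˡ (m-coef Λ w))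
      where
      len : length (w ∷ʳ 𝟙) ≡ suc (length w)
      len = trans (List.length-++ w) (ℕ.+-comm (length w) 1)
      grow : ∀ s → IsTerm Λ (length w) s w → IsTerm Λ (length (w ∷ʳ 𝟙)) s (w ∷ʳ 𝟙)
      grow s it@(t , r , refl , refl) rewrite len =
        t ∷ʳ (nothing , 0) ,
        subst ((t ∷ʳ (nothing , 0)) ↭_) (sym (leading-suc ℓ≤)) (Perm.++⁺ʳ [ (nothing , 0) ] r) ,
        sgn-∷ʳ t 0 ,
        List.map-++ forgetCell t [ (nothing , 0) ]
        where
        ℓ≤ : ℓ ≤ length (forget t)
        ℓ≤ = subst (ℓ ≤_) (sym (length-IsTerm it)) (ℕ.m≤m+n ℓ _)
      shrink : ∀ s → IsTerm Λ (length (w ∷ʳ 𝟙)) s (w ∷ʳ 𝟙) → IsTerm Λ (length w) s w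
      shrink s (t , r , refl , eq) rewrite len with map-++⁻ forgetCell t w eq
      ... | t₁ , (nothing , zero) ∷ [] , refl , refl , refl with ℓ ℕ.≤? length (forget t₁)
      ...   | yes ℓ≤ = t₁ ,
                subst₂ _↭_ (List.++-identityʳ t₁) (List.++-identityʳ _)
                  (Perm.drop-mid t₁ (leading Λ (length (forget t₁))) (subst (t ↭_) (leading-suc ℓ≤) r)) ,
                sym (sgn-∷ʳ t₁ 0) , refl
      ...   | no ℓ≰ = ⊥-elim (no-zero (ℕ.≰⇒> ℓ≰) (Perm.∈-resp-↭ r (∈-insert t₁)))

    degree-leading : ∀ N → degree (forget (leading Λ N)) ≡ m ℕ.+ n
    degree-leading N = begin
      degree (forget (fermionic 0 Λᵃ ++ bosonic (Λˢ ++ z)))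
        ≡⟨ cong degree (List.map-++ forgetCell (fermionic 0 Λᵃ) _) ⟩
      degree (forget (fermionic 0 Λᵃ) ++ forget (bosonic (Λˢ ++ z)))
        ≡⟨ degree-++ (forget (fermionic 0 Λᵃ)) _ ⟩
      degree (forget (fermionic 0 Λᵃ)) ℕ.+ degree (forget (bosonic (Λˢ ++ z)))
        ≡⟨ cong₂ ℕ._+_ (fermions 0 Λᵃ) (trans (bosons (Λˢ ++ z)) (trans (ℕ.sum-++ Λˢ z)
             (trans (cong (ℕ.sum Λˢ ℕ.+_) (zeros (N ∸ ℓ))) (ℕ.+-identityʳ _)))) ⟩
      (m ℕ.+ Vec.sum Λᵃ) ℕ.+ ℕ.sum Λˢ   ≡⟨ ℕ.+-assoc m _ _ ⟩
      m ℕ.+ (Vec.sum Λᵃ ℕ.+ ℕ.sum Λˢ)   ≡⟨ cong (m ℕ.+_) size ⟩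
      m ℕ.+ n                           ∎
      where
      open ≡-Reasoning
      z = replicate (N ∸ ℓ) 0
      zeros : ∀ j → ℕ.sum (replicate j 0) ≡ 0
      zeros zero    = refl
      zeros (suc j) = zeros j
      bosons : ∀ s → degree (forget (bosonic s)) ≡ ℕ.sum s
      bosons []      = refl
      bosons (x ∷ s) = cong (x ℕ.+_) (bosons s)
      fermions : ∀ {m} k (a : Vec ℕ m) → degree (forget (fermionic k a)) ≡ m ℕ.+ Vec.sum a
      fermions k [] = refl
      fermions {suc m} k (x ∷ a) = cong suc (trans (cong (x ℕ.+_) (fermions (suc k) a))
        (trans (sym (ℕ.+-assoc x m _)) (trans (cong (ℕ._+ Vec.sum a) (ℕ.+-comm x m)) (ℕ.+-assoc m x _))))

    m-bounded : ∀ w → m ℕ.+ n < degree w → m-coef Λ w ≡ 0ℚ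
    m-bounded w lt = trans (m-coef-ind Λ w)
      (cong₂ _-_ (ind-no (term? Λ (length w) Sign.+ w) none) (ind-no (term? Λ (length w) Sign.- w) none))
      where
      none : ∀ {s} → ¬ IsTerm Λ (length w) s w
      none (t , r , _ , refl) = ℕ.<-irrefl
        (trans (sym (degree-leading (length w))) (sym (ℕ.sum-↭ (Perm.map⁺ cellDegree (Perm.map⁺ forgetCell r))))) lt

open Monomial using (m-adjacent; m-stable; m-bounded)

m[_] : ∀ {n m} → Superpartition n m → 𝚲
m[_] {n} {m} Λ = record
  { coef      = m-coef Λ
  ; stable    = m-stable Λ
  ; symmetric = adjacent⇒symmetric (m-coef Λ) (m-adjacent Λ)
  ; bounded   = m ℕ.+ n , m-bounded Λ
  }

ones-partition : ∀ r → Linked _≥_ (replicate r 1)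
ones-partition zero          = []
ones-partition (suc zero)    = [-]
ones-partition (suc (suc r)) = s≤s z≤n ∷ ones-partition (suc r)

ones-positive : ∀ r → All (1 ≤_) (replicate r 1)
ones-positive r = All.replicate⁺ r (s≤s z≤n)

ones-sum : ∀ r → ℕ.sum (replicate r 1) ≡ r
ones-sum zero    = refl
ones-sum (suc r) = cong suc (ones-sum r)

∅⨾1^ : ∀ r → Superpartition r 0
∅⨾1^ r = superpartition ([] , replicate r 1)
  (isSuperpartition VecLinked.[] (ones-partition r) (ones-positive r) (ones-sum r))

0⨾1^ : ∀ k → Superpartition k 1
0⨾1^ k = superpartition (0 ∷ [] , replicate k 1)
  (isSuperpartition VecLinked.[-] (ones-partition k) (ones-positive k) (ones-sum k))

Λ₁ : ∀ {n m} → Superpartition n (suc m) → ℕ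
Λ₁ Λ = Vec.head (Superpartition.Λᵃ Λ)

e ẽ h h̃ : ℕ → 𝚲
e zero      = 1𝚲
e r@(suc _) = m[ ∅⨾1^ r ]

ẽ k = m[ 0⨾1^ k ]

h zero      = 1𝚲
h r@(suc _) = ∑𝚲 (superpartitions r 0) m[_]

h̃ k = ∑𝚲 (superpartitions k 1) λ Λ → (ℤ.+ suc (Λ₁ Λ) / 1) · m[ Λ ]

{-# OPTIONS --safe #-}

-- In fermionic degree 0 and 1, the e's and ẽ's, and likewise the h's and
-- h̃'s, are the homogeneous parts of one product over the variables:
--   ∏ⱼ (1 + xⱼ + θⱼ)   and   ∏ⱼ (∑_α xⱼ^α + θⱼ ∑_α (α + 1) xⱼ^α).
-- A product over the union of two sets of variables is the product of the
-- products over each set, and comparing homogeneous parts gives the four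
-- formulas.  No signs arise, as at most one θ or φ occurs.
module Submission where

open import Defs
open import Data.Nat using (ℕ; _≤_)
open import Data.Product using (_×_)

open import Data.Bool using (true; false; if_then_else_)
open import Data.Empty using (⊥-elim)
import Data.Integer as ℤ
open import Data.List as List using (List; []; _∷_; _++_; [_]; map; length; replicate; filter; upTo)
import Data.List.Properties as List
import Data.List.Membership.DecPropositional as DecMembership
open import Data.List.Membership.Propositional using (_∈_)
open import Data.List.Membership.Propositional.Properties
open import Data.List.Relation.Binary.Permutation.Propositional
  using (_↭_; ↭-sym; ↭-trans; ↭-refl; ↭-prep; ↭-reflexive; ↭⇒↭ₛ)
import Data.List.Relation.Binary.Permutation.Propositional as Perm
import Data.List.Relation.Binary.Permutation.Propositional.Properties as Perm
open import Data.List.Relation.Binary.Pointwise using (Pointwise-≡⇒≡)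
open import Data.List.Relation.Unary.All as All using (All; []; _∷_)
import Data.List.Relation.Unary.All.Properties as All
open import Data.List.Relation.Unary.AllPairs using ([]; _∷_)
open import Data.List.Relation.Unary.Any using (here; there)
open import Data.List.Relation.Unary.Linked using (Linked)
open import Data.List.Relation.Unary.Sorted.TotalOrder.Properties using (↗↭↗⇒≋)
open import Data.List.Relation.Unary.Unique.Propositional using (Unique)
import Data.List.Relation.Unary.Unique.Propositional.Properties as Unique
import Data.List.Sort as Sort
open import Data.Maybe using (just; nothing)
open import Data.Nat as ℕ using (zero; suc; _>_; _≥_; _∸_; z≤n; s≤s)
import Data.Nat.ListAction as ℕ using (sum)
import Data.Nat.ListAction.Properties as ℕ using (sum-++; sum-↭)
import Data.Nat.Properties as ℕ
open import Data.Product using (Σ; ∃-syntax; _,_; proj₁; proj₂)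
import Data.Product.Properties as Product
open import Data.Rational using (ℚ; 0ℚ; 1ℚ; _+_; _*_; _-_; _/_)
import Data.Rational.Properties as ℚ
open import Data.Rational.Solver using (module +-*-Solver)
open import Data.Sign as Sign using (Sign)
open import Data.Vec as Vec using (Vec; []; _∷_)
import Data.Vec.Properties as Vec
import Data.Vec.Relation.Unary.Linked as VecLinked
open import Function using (_∘_)
open import Relation.Binary.Bundles using (DecTotalOrder)
import Relation.Binary.Construct.Flip.EqAndOrd as Flip
open import Relation.Binary.PropositionalEquality hiding ([_])
open import Relation.Nullary using (¬_; Dec; yes; no; contradiction)
open import Relation.Nullary.Decidable using (map′)

open Enumeration using (superpartitions-unique; superpartitions-complete)
open Monomial using (IsTerm; ind; ind-cong; ind-yes; ind-no; term?; m-coef-ind; ∑-cong)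
open Superpartition using (parts)

-- Degree indicators and their convolution.

δ : ℕ → ℕ → ℚ
δ p n = ind (p ℕ.≟ n)

δ-refl : ∀ n → δ n n ≡ 1ℚ
δ-refl n = ind-yes (n ℕ.≟ n) refl

∑-+ : ∀ {A : Set} (D : List A) (φ ψ : A → ℚ) → ∑ D (λ y → φ y + ψ y) ≡ ∑ D φ + ∑ D ψ
∑-+ []      φ ψ = refl
∑-+ (x ∷ D) φ ψ = trans (cong (φ x + ψ x +_) (∑-+ D φ ψ))
  (solve 4 (λ a b c d → (a :+ b) :+ (c :+ d) := (a :+ c) :+ (b :+ d)) refl (φ x) (ψ x) (∑ D φ) (∑ D ψ))
  where open +-*-Solver

-- This is the Cauchy product of two homogeneous terms of degrees `p` and `q`. Only `k = p` can
-- contribute, and there `q = i ∸ p` is equivalent to `p + q = i`. This equivalence needs `p ≤ i`,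
-- since subtraction is truncated; for `p > i` both sides are zero.
convolution : ∀ i p q X Y →
  ∑ (upTo (suc i)) (λ k → (δ p k * X) * (δ q (i ∸ k) * Y)) ≡ δ (p ℕ.+ q) i * (X * Y)
convolution i p q X Y with p ℕ.≤? i
... | yes p≤i = trans (∑-single φ (Unique.upTo⁺ (suc i)) (∈-upTo⁺ (s≤s p≤i)) off) at-p
  where
  open +-*-Solver
  φ : ℕ → ℚ
  φ k = (δ p k * X) * (δ q (i ∸ k) * Y)
  off : ∀ {k} → k ∈ upTo (suc i) → k ≢ p → φ k ≡ 0ℚ
  off {k} _ k≢p rewrite ind-no (p ℕ.≟ k) (k≢p ∘ sym) =
    solve 2 (λ x y → (con 0ℚ :* x) :* y := con 0ℚ) refl X (δ q (i ∸ k) * Y)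
  shifted : δ q (i ∸ p) ≡ δ (p ℕ.+ q) i
  shifted = ind-cong (q ℕ.≟ i ∸ p) (p ℕ.+ q ℕ.≟ i)
    (λ eq → trans (cong (p ℕ.+_) eq) (ℕ.m+[n∸m]≡n p≤i))
    (λ eq → trans (sym (ℕ.m+n∸m≡n p q)) (cong (_∸ p) eq))
  at-p : φ p ≡ δ (p ℕ.+ q) i * (X * Y)
  at-p rewrite δ-refl p | shifted =
    solve 3 (λ d x y → (con 1ℚ :* x) :* (d :* y) := d :* (x :* y)) refl (δ (p ℕ.+ q) i) X Y
... | no p≰i = trans (∑-zero (upTo (suc i)) off)
    (sym (trans (cong (_* (X * Y)) (ind-no (p ℕ.+ q ℕ.≟ i) λ { refl → p≰i (ℕ.m≤m+n p q) })) (ℚ.*-zeroˡ (X * Y))))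
  where
  open +-*-Solver
  off : ∀ {k} → k ∈ upTo (suc i) → (δ p k * X) * (δ q (i ∸ k) * Y) ≡ 0ℚ
  off {k} k∈ rewrite ind-no (p ℕ.≟ k) (λ { refl → p≰i (ℕ.≤-pred (∈-upTo⁻ k∈)) }) =
    solve 2 (λ x y → (con 0ℚ :* x) :* y := con 0ℚ) refl X (δ q (i ∸ k) * Y)

-- Homogeneous parts of a product over the variables.

θdeg xdeg : Mono → ℕ
θdeg w = ℕ.sum (map (λ c → if proj₁ c then 1 else 0) w)
xdeg w = ℕ.sum (map proj₂ w)

θdeg-++ : ∀ u v → θdeg (u ++ v) ≡ θdeg u ℕ.+ θdeg v
θdeg-++ u v = trans (cong ℕ.sum (List.map-++ _ u v)) (ℕ.sum-++ (map _ u) _)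

xdeg-++ : ∀ u v → xdeg (u ++ v) ≡ xdeg u ℕ.+ xdeg v
xdeg-++ u v = trans (cong ℕ.sum (List.map-++ proj₂ u v)) (ℕ.sum-++ (map proj₂ u) _)

θdeg-↭ : ∀ {u v} → u ↭ v → θdeg u ≡ θdeg v
θdeg-↭ r = ℕ.sum-↭ (Perm.map⁺ _ r)

xdeg-↭ : ∀ {u v} → u ↭ v → xdeg u ≡ xdeg v
xdeg-↭ r = ℕ.sum-↭ (Perm.map⁺ proj₂ r)

weight : (Cell → ℚ) → Mono → ℚ
weight κ []      = 1ℚ
weight κ (c ∷ w) = κ c * weight κ w

weight-++ : ∀ κ u v → weight κ (u ++ v) ≡ weight κ u * weight κ v
weight-++ κ []      v = sym (ℚ.*-identityˡ (weight κ v))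
weight-++ κ (c ∷ u) v = trans (cong (κ c *_) (weight-++ κ u v)) (sym (ℚ.*-assoc (κ c) (weight κ u) (weight κ v)))

weight-↭ : ∀ κ {u v} → u ↭ v → weight κ u ≡ weight κ v
weight-↭ κ Perm.refl = refl
weight-↭ κ (Perm.prep c r) = cong (κ c *_) (weight-↭ κ r)
weight-↭ κ {v = _ ∷ _ ∷ v} (Perm.swap c d r) = trans (cong (λ z → κ c * (κ d * z)) (weight-↭ κ r))
  (solve 3 (λ x y z → x :* (y :* z) := y :* (x :* z)) refl (κ c) (κ d) (weight κ v))
  where open +-*-Solver
weight-↭ κ (Perm.trans r s) = trans (weight-↭ κ r) (weight-↭ κ s)

-- The coefficients of the part of degree n in the x's and m in the θ's of
-- the generating function ∏ⱼ ∑ κ (ε , α) θⱼ^ε xⱼ^α.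
gen : (Cell → ℚ) → ℕ → ℕ → Mono → ℚ
gen κ n m w = δ (xdeg w) n * (δ (θdeg w) m * weight κ w)

gen-↭ : ∀ κ n m {u v} → u ↭ v → gen κ n m u ≡ gen κ n m v
gen-↭ κ n m r rewrite xdeg-↭ r | θdeg-↭ r | weight-↭ κ r = refl

gen-off : ∀ κ n m w → ¬ (xdeg w ≡ n × θdeg w ≡ m) → gen κ n m w ≡ 0ℚ
gen-off κ n m w ne with xdeg w ℕ.≟ n
... | no p  = trans (cong (_* (δ (θdeg w) m * weight κ w)) (ind-no (xdeg w ℕ.≟ n) p)) (ℚ.*-zeroˡ (δ (θdeg w) m * weight κ w))
... | yes p = trans (cong (λ z → δ (xdeg w) n * (z * weight κ w)) (ind-no (θdeg w ℕ.≟ m) (λ q → ne (p , q))))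
  (trans (cong (δ (xdeg w) n *_) (ℚ.*-zeroˡ (weight κ w))) (ℚ.*-zeroʳ (δ (xdeg w) n)))

gen-on : ∀ κ w → gen κ (xdeg w) (θdeg w) w ≡ weight κ w
gen-on κ w rewrite δ-refl (xdeg w) | δ-refl (θdeg w) = trans (ℚ.*-identityˡ _) (ℚ.*-identityˡ _)

-- A cell other than `𝟙` has positive degree, so the bidegree (0,0) part sees only trivial cells.
-- The normalization `κ 𝟙 ≡ 1ℚ` lets each of these be dropped.
gen-1 : ∀ κ → κ 𝟙 ≡ 1ℚ → ∀ w → 1-coef w ≡ gen κ 0 0 w
gen-1 κ κ𝟙 [] = refl
gen-1 κ κ𝟙 ((true , α) ∷ w) = sym (gen-off κ 0 0 ((true , α) ∷ w) λ ())
gen-1 κ κ𝟙 ((false , suc α) ∷ w) = sym (gen-off κ 0 0 ((false , suc α) ∷ w) λ ())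
gen-1 κ κ𝟙 ((false , zero) ∷ w) rewrite κ𝟙 | ℚ.*-identityˡ (weight κ w) = gen-1 κ κ𝟙 w

-- Degrees and weights of leading monomials.

cells : ∀ {m} → Vec ℕ m → List ℕ → Mono
cells a s = map (true ,_) (Vec.toList a) ++ map (false ,_) s

forget-cells : ∀ {m} k (a : Vec ℕ m) s → forget (fermionic k a ++ bosonic s) ≡ cells a s
forget-cells k []      s = sym (List.map-∘ s)
forget-cells k (x ∷ a) s = cong (_ ∷_) (forget-cells (suc k) a s)

θdeg-cells : ∀ {m} (a : Vec ℕ m) s → θdeg (cells a s) ≡ m
θdeg-cells []      []      = refl
θdeg-cells []      (_ ∷ s) = θdeg-cells [] s
θdeg-cells (_ ∷ a) s       = cong suc (θdeg-cells a s)

xdeg-cells : ∀ {m} (a : Vec ℕ m) s → xdeg (cells a s) ≡ Vec.sum a ℕ.+ ℕ.sum s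
xdeg-cells []      []      = refl
xdeg-cells []      (x ∷ s) = cong (x ℕ.+_) (xdeg-cells [] s)
xdeg-cells (x ∷ a) s       = trans (cong (x ℕ.+_) (xdeg-cells a s)) (sym (ℕ.+-assoc x (Vec.sum a) (ℕ.sum s)))

length-cells : ∀ {m} (a : Vec ℕ m) s → length (cells a s) ≡ m ℕ.+ length s
length-cells []      s = List.length-map _ s
length-cells (_ ∷ a) s = cong suc (length-cells a s)

sum-zeros : ∀ s j → ℕ.sum (s ++ replicate j 0) ≡ ℕ.sum s
sum-zeros []      zero    = refl
sum-zeros []      (suc j) = sum-zeros [] j
sum-zeros (x ∷ s) j       = cong (x ℕ.+_) (sum-zeros s j)

lead : ∀ {n m} → Superpartition n m → ℕ → Mono
lead Λ N = forget (leading Λ N)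

lead-cells : ∀ {n m} (Λ : Superpartition n m) N →
  lead Λ N ≡ cells (Superpartition.Λᵃ Λ)
               (Superpartition.Λˢ Λ ++ replicate (N ∸ (m ℕ.+ length (Superpartition.Λˢ Λ))) 0)
lead-cells Λ N = forget-cells 0 (Superpartition.Λᵃ Λ) _

θdeg-lead : ∀ {n m} (Λ : Superpartition n m) N → θdeg (lead Λ N) ≡ m
θdeg-lead Λ N = trans (cong θdeg (lead-cells Λ N)) (θdeg-cells (Superpartition.Λᵃ Λ) _)

xdeg-lead : ∀ {n m} (Λ : Superpartition n m) N → xdeg (lead Λ N) ≡ n
xdeg-lead {m = m} Λ N = trans (cong xdeg (lead-cells Λ N)) (trans (xdeg-cells Λᵃ _)
  (trans (cong (Vec.sum Λᵃ ℕ.+_) (sum-zeros Λˢ (N ∸ (m ℕ.+ length Λˢ)))) size))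
  where open Superpartition Λ

gen-lead : ∀ κ {n m} (Λ : Superpartition n m) N → gen κ n m (lead Λ N) ≡ weight κ (lead Λ N)
gen-lead κ Λ N = trans (cong₂ (λ p q → gen κ p q (lead Λ N)) (sym (xdeg-lead Λ N)) (sym (θdeg-lead Λ N)))
  (gen-on κ (lead Λ N))

-- Monomials with at most one θ, up to permutation, are superpartitions.

≥-decTotalOrder : DecTotalOrder _ _ _
≥-decTotalOrder = Flip.decTotalOrder ℕ.≤-decTotalOrder

-- In the flipped order a weakly decreasing list is a sorted one, and two sorted arrangements of the
-- same multiset agree.
partition-↭⇒≡ : ∀ {s t} → Linked _≥_ s → Linked _≥_ t → s ↭ t → s ≡ t
partition-↭⇒≡ ls lt r =
  Pointwise-≡⇒≡ (↗↭↗⇒≋ (DecTotalOrder.totalOrder ≥-decTotalOrder) ls lt (↭⇒↭ₛ r))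

positives : List ℕ → List ℕ
positives = filter (1 ℕ.≤?_)

positives-padded : ∀ {s} j → All (1 ≤_) s → positives (s ++ replicate j 0) ≡ s
positives-padded zero    []       = refl
positives-padded (suc j) []       = positives-padded j []
positives-padded j       (p ∷ ps) = trans (List.filter-accept (1 ℕ.≤?_) p) (cong (_ ∷_) (positives-padded j ps))

positives-↭ : ∀ s → ∃[ j ] s ↭ positives s ++ replicate j 0
positives-↭ [] = 0 , ↭-refl
positives-↭ (zero ∷ s) with positives-↭ s
... | j , r = suc j , ↭-trans (↭-prep 0 r) (↭-sym (Perm.shift 0 (positives s) (replicate j 0)))
positives-↭ (suc x ∷ s) with positives-↭ s
... | j , r = j , ↭-prep (suc x) r

map-false-↭ : ∀ {s t} → map {B = Cell} (false ,_) s ↭ map (false ,_) t → s ↭ t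
map-false-↭ {s} {t} r = subst₂ _↭_ (proj₂-map s) (proj₂-map t) (Perm.map⁺ proj₂ r)
  where
  proj₂-map : ∀ s → map proj₂ (map {B = Cell} (false ,_) s) ≡ s
  proj₂-map s = trans (sym (List.map-∘ s)) (List.map-id s)

-- The Boolean tag tells fermionic cells from bosonic ones. With at most one fermionic cell there is
-- no order among them to lose, so the vectors are equal and not merely permuted.
cells-↭ : ∀ {m} (a b : Vec ℕ m) {s t} → m ≤ 1 → cells a s ↭ cells b t → a ≡ b × s ↭ t
cells-↭ [] [] _ r = refl , map-false-↭ r
cells-↭ (_ ∷ _ ∷ _) _ (s≤s ()) _
cells-↭ (x ∷ []) (y ∷ []) {s} {t} _ r with Perm.∈-resp-↭ r (here refl)
... | here refl = refl , map-false-↭ (Perm.drop-∷ r)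
... | there i with ∈-map⁻ {B = Cell} (false ,_) i
...   | _ , _ , ()

-- After the fermionic part is matched, discarding the padding zeros leaves two partitions that are
-- rearrangements of each other, hence equal.
lead-injective : ∀ {n m} → m ≤ 1 → (Λ Ω : Superpartition n m) → ∀ N → lead Λ N ↭ lead Ω N → parts Λ ≡ parts Ω
lead-injective m≤1 Λ Ω N r
  with eq , r′ ← cells-↭ (Superpartition.Λᵃ Λ) (Superpartition.Λᵃ Ω) m≤1 (subst₂ _↭_ (lead-cells Λ N) (lead-cells Ω N) r)
  = cong₂ _,_ eq (partition-↭⇒≡ (Superpartition.partition Λ) (Superpartition.partition Ω)
      (subst₂ _↭_ (positives-padded _ (Superpartition.positive Λ)) (positives-padded _ (Superpartition.positive Ω))
        (Perm.filter-↭ (1 ℕ.≤?_) r′)))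

separate : ∀ w → Σ (Vec ℕ (θdeg w)) λ a → ∃[ s ] w ↭ cells a s
separate [] = [] , [] , ↭-refl
separate ((true , α) ∷ w) with a , s , r ← separate w = α ∷ a , s , ↭-prep _ r
separate ((false , α) ∷ w) with a , s , r ← separate w =
  a , α ∷ s , ↭-trans (↭-prep _ r) (↭-sym (Perm.shift _ (map (true ,_) (Vec.toList a)) (map (false ,_) s)))

short-strict : ∀ {m} → m ≤ 1 → (a : Vec ℕ m) → VecLinked.Linked _>_ a
short-strict _ []       = VecLinked.[]
short-strict _ (_ ∷ []) = VecLinked.[-]
short-strict (s≤s ()) (_ ∷ _ ∷ _)

-- The θ-cell, if any, gives `Λᵃ`, and sorting the positive exponents of the other cells gives `Λˢ`.
-- The cells equal to `𝟙` become the padding.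
shape : ∀ w → θdeg w ≤ 1 → Σ (Superpartition (xdeg w) (θdeg w)) λ Λ → w ↭ lead Λ (length w)
shape w θ≤1 with a , s , r ← separate w with j , rˢ ← positives-↭ s =
  Λ , ↭-trans w↭ (↭-reflexive (trans (cong (λ i → cells a (p ++ replicate i 0)) j≡) (sym (lead-cells Λ (length w)))))
  where
  open Sort ≥-decTotalOrder using (sort; sort-↭; sort-↗)
  p = sort (positives s)
  w↭ : w ↭ cells a (p ++ replicate j 0)
  w↭ = ↭-trans r (Perm.++⁺ˡ _ (Perm.map⁺ _ (↭-trans rˢ (Perm.++⁺ʳ _ (↭-sym (sort-↭ (positives s)))))))
  Λ : Superpartition (xdeg w) (θdeg w)
  Λ = superpartition (a , p) (isSuperpartition (short-strict θ≤1 a) (sort-↗ (positives s))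
    (Perm.All-resp-↭ (↭-sym (sort-↭ (positives s))) (All.all-filter (1 ℕ.≤?_) s))
    (sym (trans (xdeg-↭ w↭) (trans (xdeg-cells a _) (cong (Vec.sum a ℕ.+_) (sum-zeros p j))))))
  -- The number of discarded zeros must be the padding that `leading` inserts; comparing lengths
  -- across the permutation forces this.
  j≡ : j ≡ length w ∸ (θdeg w ℕ.+ length p)
  j≡ = begin
    j ≡⟨ ℕ.m+n∸m≡n (θdeg w ℕ.+ length p) j ⟨
    θdeg w ℕ.+ length p ℕ.+ j ∸ ℓ ≡⟨ cong (_∸ ℓ) (ℕ.+-assoc (θdeg w) (length p) j) ⟩
    θdeg w ℕ.+ (length p ℕ.+ j) ∸ ℓ
      ≡⟨ cong (λ i → θdeg w ℕ.+ i ∸ ℓ) (trans (List.length-++ p) (cong (length p ℕ.+_) (List.length-replicate j))) ⟨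
    θdeg w ℕ.+ length (p ++ replicate j 0) ∸ ℓ
      ≡⟨ cong (_∸ ℓ) (trans (Perm.↭-length w↭) (length-cells a _)) ⟨
    length w ∸ ℓ ∎
    where
    open ≡-Reasoning
    ℓ = θdeg w ℕ.+ length p

-- Coefficients of monomial symmetric functions with at most one θ.

-- A permutation of leading Λ in which every θ carries the label 0 contains
-- no inversion; for m ≤ 1 this makes all terms of m_Λ positive.
smaller-zero : ∀ {t} → All (λ c → ∀ k → proj₁ c ≡ just k → k ≡ 0) t → smaller 0 t ≡ Sign.+
smaller-zero []                      = refl
smaller-zero {(nothing , _) ∷ t} (_ ∷ ls) = smaller-zero ls
smaller-zero {(just k , _) ∷ t} (l ∷ ls) with refl ← l k refl = smaller-zero ls

sgn-zero : ∀ {t} → All (λ c → ∀ k → proj₁ c ≡ just k → k ≡ 0) t → sgn t ≡ Sign.+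
sgn-zero []                      = refl
sgn-zero {(nothing , _) ∷ t} (_ ∷ ls) = sgn-zero ls
sgn-zero {(just k , _) ∷ t} (l ∷ ls) with refl ← l k refl = cong₂ Sign._*_ (smaller-zero ls) (sgn-zero ls)

leading-labels : ∀ {m} → m ≤ 1 → (a : Vec ℕ m) → ∀ s →
  All (λ c → ∀ k → proj₁ c ≡ just k → k ≡ 0) (fermionic 0 a ++ bosonic s)
leading-labels _ []       s = All.map⁺ (All.universal (λ _ _ ()) s)
leading-labels _ (_ ∷ []) s = (λ { _ refl → refl }) ∷ All.map⁺ (All.universal (λ _ _ ()) s)
leading-labels (s≤s ()) (_ ∷ _ ∷ _) s

module _ {n m} (m≤1 : m ≤ 1) (Λ : Superpartition n m) (w : Mono) where

  term-sign : ∀ {s} → IsTerm Λ (length w) s w → Sign.+ ≡ s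
  term-sign (t , r , eq , _) =
    trans (sym (sgn-zero (Perm.All-resp-↭ (↭-sym r) (leading-labels m≤1 (Superpartition.Λᵃ Λ) _)))) eq

  -- A rearrangement of the unlabelled monomial lifts to a rearrangement of the labelled term. The
  -- lift has some sign, which `term-sign` then identifies as positive.
  lead⇒term : w ↭ lead Λ (length w) → IsTerm Λ (length w) Sign.+ w
  lead⇒term r with t , refl , r′ ← Perm.↭-map-inv forgetCell (↭-sym r) =
    subst (λ s → IsTerm Λ (length (forget t)) s (forget t)) (sym (term-sign it)) it
    where
    it : IsTerm Λ (length (forget t)) (sgn t) (forget t)
    it = t , ↭-sym r′ , refl , refl

  term⇒lead : ∀ {s} → IsTerm Λ (length w) s w → w ↭ lead Λ (length w)
  term⇒lead (t , r , _ , eq) = subst (_↭ lead Λ (length w)) eq (Perm.map⁺ forgetCell r)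

  -- Decided through the finite list of distinct terms, since being a rearrangement of `lead Λ` is
  -- the same as occurring there with sign +.
  lead? : Dec (w ↭ lead Λ (length w))
  lead? = map′ term⇒lead lead⇒term (term? Λ (length w) Sign.+ w)

  m-coef-lead : w ↭ lead Λ (length w) → m-coef Λ w ≡ 1ℚ
  m-coef-lead r = trans (m-coef-ind Λ w)
    (cong₂ _-_ (ind-yes (term? Λ (length w) Sign.+ w) (lead⇒term r))
               (ind-no (term? Λ (length w) Sign.- w) (λ i → contradiction (term-sign i) λ ())))

  m-coef-other : ¬ (w ↭ lead Λ (length w)) → m-coef Λ w ≡ 0ℚ
  m-coef-other ¬r = trans (m-coef-ind Λ w)
    (cong₂ _-_ (ind-no (term? Λ (length w) Sign.+ w) (¬r ∘ term⇒lead))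
               (ind-no (term? Λ (length w) Sign.- w) (¬r ∘ term⇒lead)))

-- Expansion of a homogeneous part in the monomial symmetric functions.

-- Used with `f = parts`: members of a list with distinct parts are identified by their parts, so
-- their validity proofs never have to be compared.
map-injective-∈ : ∀ {A B : Set} (f : A → B) {xs x y} → Unique (map f xs) → x ∈ xs → y ∈ xs → f x ≡ f y → x ≡ y
map-injective-∈ f _          (here refl) (here refl) _  = refl
map-injective-∈ f (x∉ ∷ _)   (here refl) (there y∈)  eq = ⊥-elim (All.lookup x∉ (∈-map⁺ f y∈) eq)
map-injective-∈ f (y∉ ∷ _)   (there x∈)  (here refl) eq = ⊥-elim (All.lookup y∉ (∈-map⁺ f x∈) (sym eq))
map-injective-∈ f (_ ∷ uq)   (there x∈)  (there y∈)  eq = map-injective-∈ f uq x∈ y∈ eq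

module _ (κ : Cell → ℚ) {n m} (m≤1 : m ≤ 1) (L : List (Superpartition n m)) (uq : Unique (map parts L))
         (c : Superpartition n m → ℚ)
         (c-lead : ∀ {Λ} → Λ ∈ L → ∀ N → weight κ (lead Λ N) ≡ c Λ)
         (others : ∀ (Λ : Superpartition n m) → ¬ (parts Λ ∈ map parts L) → ∀ N → weight κ (lead Λ N) ≡ 0ℚ)
         where

  private
    term : Mono → Superpartition n m → ℚ
    term w Λ = c Λ * m-coef Λ w

    on-lead : ∀ {Λ w} → w ↭ lead Λ (length w) → gen κ n m w ≡ weight κ (lead Λ (length w))
    on-lead {Λ} {w} r = trans (gen-↭ κ n m r) (gen-lead κ Λ (length w))

    -- If `w` rearranges the leading monomial of some `Λ` in `L`, then `c Λ` is itself the vanishing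
    -- value `gen κ n m w`. Otherwise `m-coef Λ w` vanishes.
    vanish : ∀ w → gen κ n m w ≡ 0ℚ → ∑ L (term w) ≡ 0ℚ
    vanish w gw≡0 = ∑-zero L λ {Λ} Λ∈ → case Λ Λ∈ (lead? m≤1 Λ w)
      where
      case : ∀ Λ → Λ ∈ L → Dec (w ↭ lead Λ (length w)) → term w Λ ≡ 0ℚ
      case Λ Λ∈ (yes r) = trans (cong (_* m-coef Λ w) (trans (sym (c-lead Λ∈ (length w))) (trans (sym (on-lead {Λ} r)) gw≡0)))
                                (ℚ.*-zeroˡ (m-coef Λ w))
      case Λ Λ∈ (no ¬r) = trans (cong (c Λ *_) (m-coef-other m≤1 Λ w ¬r)) (ℚ.*-zeroʳ (c Λ))

    single : ∀ w Λ → Λ ∈ L → w ↭ lead Λ (length w) → ∑ L (term w) ≡ gen κ n m w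
    single w Λ Λ∈ r = begin
      ∑ L (term w)              ≡⟨ ∑-single (term w) (Unique.map⁻ uq) Λ∈ off ⟩
      c Λ * m-coef Λ w          ≡⟨ cong (c Λ *_) (m-coef-lead m≤1 Λ w r) ⟩
      c Λ * 1ℚ                  ≡⟨ ℚ.*-identityʳ (c Λ) ⟩
      c Λ                       ≡⟨ c-lead Λ∈ (length w) ⟨
      weight κ (lead Λ (length w)) ≡⟨ on-lead {Λ} r ⟨
      gen κ n m w               ∎
      where
      open ≡-Reasoning
      -- A second `Ω` matching `w` would have a leading monomial permuted from that of `Λ`, hence
      -- the same parts.
      off : ∀ {Ω} → Ω ∈ L → Ω ≢ Λ → term w Ω ≡ 0ℚ
      off {Ω} Ω∈ Ω≢Λ = trans
        (cong (c Ω *_) (m-coef-other m≤1 Ω w λ r′ → Ω≢Λ (map-injective-∈ parts uq Ω∈ Λ∈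
          (lead-injective m≤1 Ω Λ (length w) (↭-trans (↭-sym r′) r)))))
        (ℚ.*-zeroʳ (c Ω))

  open DecMembership (Product.≡-dec (Vec.≡-dec {n = m} ℕ._≟_) (List.≡-dec ℕ._≟_)) using (_∈?_)

  -- Both sides are invariant under permuting cells, so they need comparing only on leading
  -- monomials. There `m-coef` is 1 for the one matching superpartition, whose coefficient is the
  -- weight; superpartitions outside `L` have weight zero by `others`.
  ∑-m-coef : ∀ w → ∑ L (λ Λ → c Λ * m-coef Λ w) ≡ gen κ n m w
  ∑-m-coef w with xdeg w ℕ.≟ n | θdeg w ℕ.≟ m
  ... | no p | _ = trans (vanish w off) (sym off)
    where off = gen-off κ n m w (p ∘ proj₁)
  ... | yes _ | no q = trans (vanish w off) (sym off)
    where off = gen-off κ n m w (q ∘ proj₂)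
  ... | yes refl | yes refl with Λ , r ← shape w m≤1 with parts Λ ∈? map parts L
  ...   | no Λ∉ = trans (vanish w off) (sym off)
    where off = trans (on-lead {Λ} r) (others Λ Λ∉ (length w))
  -- The member `Ω` of `L` may carry another validity proof than `Λ`, but `lead` reads only the
  -- parts, so `r` serves for `Ω` too.
  ...   | yes i with Ω@(superpartition _ _) , Ω∈ , refl ← ∈-map⁻ parts i = single w Ω Ω∈ r

-- The four families as homogeneous parts of products.

-- The coefficients of one factor: `1 + x + θ` for `κᵉ`, and `1/(1 - x) + θ/(1 - x)²` for `κʰ`.
κᵉ κʰ : Cell → ℚ
κᵉ (false , 0)           = 1ℚ
κᵉ (false , 1)           = 1ℚ
κᵉ (false , suc (suc _)) = 0ℚ
κᵉ (true , 0)            = 1ℚ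
κᵉ (true , suc _)        = 0ℚ
κʰ (false , _) = 1ℚ
κʰ (true , α)  = ℤ.+ suc α / 1

weight-ones : ∀ r j → weight κᵉ (cells [] (replicate r 1 ++ replicate j 0)) ≡ 1ℚ
weight-ones zero    zero    = refl
weight-ones zero    (suc j) = trans (ℚ.*-identityˡ _) (weight-ones zero j)
weight-ones (suc r) j       = trans (ℚ.*-identityˡ _) (weight-ones r j)

-- A list of positive parts that are not all 1 has a part of size at least 2, and `κᵉ` kills it.
weight-others : ∀ s j → All (1 ≤_) s → s ≢ replicate (ℕ.sum s) 1 → weight κᵉ (cells [] (s ++ replicate j 0)) ≡ 0ℚ
weight-others []                j _        ne = ⊥-elim (ne refl)
weight-others (1 ∷ s)           j (_ ∷ ps) ne =
  trans (ℚ.*-identityˡ _) (weight-others s j ps (ne ∘ cong (1 ∷_)))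
weight-others (suc (suc x) ∷ s) j _        ne = ℚ.*-zeroˡ (weight κᵉ (cells [] (s ++ replicate j 0)))

weight-h : ∀ s → weight κʰ (cells [] s) ≡ 1ℚ
weight-h []      = refl
weight-h (_ ∷ s) = trans (ℚ.*-identityˡ _) (weight-h s)

∑𝚲-coef : ∀ {A : Set} (xs : List A) F w → 𝚲.coef (∑𝚲 xs F) w ≡ ∑ xs (λ x → 𝚲.coef (F x) w)
∑𝚲-coef []       F w = refl
∑𝚲-coef (x ∷ xs) F w = cong (𝚲.coef (F x) w +_) (∑𝚲-coef xs F w)

one-term : ∀ q → 1ℚ * q + 0ℚ ≡ q
one-term q = trans (ℚ.+-identityʳ (1ℚ * q)) (ℚ.*-identityˡ q)

e-gen : ∀ r w → 𝚲.coef (e r) w ≡ gen κᵉ r 0 w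
e-gen zero      w = gen-1 κᵉ refl w
e-gen r@(suc _) w = trans (sym (one-term (m-coef (∅⨾1^ r) w)))
  (∑-m-coef κᵉ z≤n [ ∅⨾1^ r ] ([] ∷ []) (λ _ → 1ℚ) on off w)
  where
  on : ∀ {Λ} → Λ ∈ [ ∅⨾1^ r ] → ∀ N → weight κᵉ (lead Λ N) ≡ 1ℚ
  on (here refl) N = trans (cong (weight κᵉ) (lead-cells (∅⨾1^ r) N)) (weight-ones r _)
  off : ∀ (Λ : Superpartition r 0) → ¬ (parts Λ ∈ map parts [ ∅⨾1^ r ]) → ∀ N → weight κᵉ (lead Λ N) ≡ 0ℚ
  off Λ@(superpartition ([] , s) (isSuperpartition _ _ ps size)) ne N =
    trans (cong (weight κᵉ) (lead-cells Λ N)) (weight-others s _ ps (λ eq → ne (here (cong ([] ,_) (trans eq (cong (λ n → replicate n 1) size))))))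

-- In `κᵉ` the θ never comes with a power of its own x, so `Λᵃ` must be (0); the remaining parts are
-- all 1 as in the bosonic case.
ẽ-gen : ∀ k w → 𝚲.coef (ẽ k) w ≡ gen κᵉ k 1 w
ẽ-gen k w = trans (sym (one-term (m-coef (0⨾1^ k) w)))
  (∑-m-coef κᵉ ℕ.≤-refl [ 0⨾1^ k ] ([] ∷ []) (λ _ → 1ℚ) on off w)
  where
  on : ∀ {Λ} → Λ ∈ [ 0⨾1^ k ] → ∀ N → weight κᵉ (lead Λ N) ≡ 1ℚ
  on (here refl) N = trans (cong (weight κᵉ) (lead-cells (0⨾1^ k) N)) (trans (ℚ.*-identityˡ _) (weight-ones k _))
  off : ∀ (Λ : Superpartition k 1) → ¬ (parts Λ ∈ map parts [ 0⨾1^ k ]) → ∀ N → weight κᵉ (lead Λ N) ≡ 0ℚ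
  off Λ@(superpartition (suc _ ∷ [] , s) _) ne N =
    trans (cong (weight κᵉ) (lead-cells Λ N)) (ℚ.*-zeroˡ (weight κᵉ (cells [] (s ++ replicate (N ∸ suc (length s)) 0))))
  off Λ@(superpartition (zero ∷ [] , s) (isSuperpartition _ _ ps size)) ne N =
    trans (cong (weight κᵉ) (lead-cells Λ N)) (trans (ℚ.*-identityˡ _)
      (weight-others s _ ps (λ eq → ne (here (cong (0 ∷ [] ,_) (trans eq (cong (λ n → replicate n 1) size)))))))

-- The enumeration is complete, so the condition on superpartitions outside the list is vacuous.
∑-superpartitions : ∀ n {m} → m ≤ 1 → (c : Superpartition n m → ℚ) →
  (∀ Λ N → weight κʰ (lead Λ N) ≡ c Λ) → ∀ w → ∑ (superpartitions n m) (λ Λ → c Λ * m-coef Λ w) ≡ gen κʰ n m w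
∑-superpartitions n {m} m≤1 c c-lead = ∑-m-coef κʰ m≤1 (superpartitions n m) (superpartitions-unique n m) c
  (λ {Λ} _ → c-lead Λ) (λ Λ Λ∉ → ⊥-elim (Λ∉ (superpartitions-complete Λ)))

h-gen : ∀ r w → 𝚲.coef (h r) w ≡ gen κʰ r 0 w
h-gen zero      w = gen-1 κʰ refl w
h-gen r@(suc _) w = begin
  𝚲.coef (h r) w                                     ≡⟨ ∑𝚲-coef (superpartitions r 0) m[_] w ⟩
  ∑ (superpartitions r 0) (λ Λ → m-coef Λ w)
    ≡⟨ ∑-cong (superpartitions r 0) (λ Λ → ℚ.*-identityˡ (m-coef Λ w)) ⟨
  ∑ (superpartitions r 0) (λ Λ → 1ℚ * m-coef Λ w)    ≡⟨ ∑-superpartitions r z≤n (λ _ → 1ℚ) weight-lead w ⟩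
  gen κʰ r 0 w                                       ∎
  where
  open ≡-Reasoning
  weight-lead : ∀ (Λ : Superpartition r 0) N → weight κʰ (lead Λ N) ≡ 1ℚ
  weight-lead Λ@(superpartition ([] , s) _) N = trans (cong (weight κʰ) (lead-cells Λ N)) (weight-h (s ++ replicate (N ∸ length s) 0))

-- Bosonic cells have weight 1 under `κʰ`, so the weight of a leading monomial is that of its one
-- fermionic cell, which is the factor `Λ₁ + 1` in the definition of `h̃`.
h̃-gen : ∀ k w → 𝚲.coef (h̃ k) w ≡ gen κʰ k 1 w
h̃-gen k w = trans (∑𝚲-coef (superpartitions k 1) (λ Λ → c Λ · m[ Λ ]) w)
  (∑-superpartitions k ℕ.≤-refl c weight-lead w)
  where
  c : Superpartition k 1 → ℚ
  c Λ = ℤ.+ suc (Λ₁ Λ) / 1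
  weight-lead : ∀ (Λ : Superpartition k 1) N → weight κʰ (lead Λ N) ≡ c Λ
  weight-lead Λ@(superpartition (α ∷ [] , s) _) N = trans (cong (weight κʰ) (lead-cells Λ N))
    (trans (cong (κʰ (true , α) *_) (weight-h (s ++ replicate (N ∸ suc (length s)) 0))) (ℚ.*-identityʳ _))

-- The coproduct formulas for any such pair of families.

∑⊗-coef : ∀ i F u v → 𝚲⊗𝚲.coef (∑⊗ i F) u v ≡ ∑ (upTo (suc i)) (λ k → 𝚲⊗𝚲.coef (F k (i ∸ k)) u v)
∑⊗-coef i F u v = go (upTo (suc i))
  where
  go : ∀ ks → 𝚲⊗𝚲.coef (List.foldr (λ k s → F k (i ∸ k) ⊕ s) 0⊗ ks) u v ≡ ∑ ks (λ k → 𝚲⊗𝚲.coef (F k (i ∸ k)) u v)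
  go []       = refl
  go (k ∷ ks) = cong (𝚲⊗𝚲.coef (F k (i ∸ k)) u v +_) (go ks)

δ-+-0 : ∀ p q → δ (p ℕ.+ q) 0 ≡ δ p 0 * δ q 0
δ-+-0 zero    q = sym (ℚ.*-identityˡ (δ q 0))
δ-+-0 (suc p) q = sym (ℚ.*-zeroˡ (δ q 0))

-- The single θ lies in exactly one of the two sets of variables; this is the source of the two
-- summands in the tilde formulas.
δ-+-1 : ∀ p q → δ (p ℕ.+ q) 1 ≡ δ p 1 * δ q 0 + δ p 0 * δ q 1
δ-+-1 zero q = solve 2 (λ x y → y := con 0ℚ :* x :+ con 1ℚ :* y) refl (δ q 0) (δ q 1)
  where open +-*-Solver
δ-+-1 (suc zero) q = solve 2 (λ x y → x := con 1ℚ :* x :+ con 0ℚ :* y) refl (δ q 0) (δ q 1)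
  where open +-*-Solver
δ-+-1 (suc (suc p)) q = solve 2 (λ x y → con 0ℚ := con 0ℚ :* x :+ con 0ℚ :* y) refl (δ q 0) (δ q 1)
  where open +-*-Solver

gen-++ : ∀ κ n m u v → gen κ n m (u ++ v) ≡
  δ (xdeg u ℕ.+ xdeg v) n * (δ (θdeg u ℕ.+ θdeg v) m * (weight κ u * weight κ v))
gen-++ κ n m u v rewrite xdeg-++ u v | θdeg-++ u v | weight-++ κ u v = refl

module _ (κ : Cell → ℚ) (f f̃ : ℕ → 𝚲)
         (f-gen : ∀ k w → 𝚲.coef (f k) w ≡ gen κ k 0 w)
         (f̃-gen : ∀ k w → 𝚲.coef (f̃ k) w ≡ gen κ k 1 w) where

  open ≡-Reasoning
  open +-*-Solver

  -- The weight is multiplicative under concatenation and fermionic degree 0 splits only as 0 + 0,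
  -- so `convolution` distributes the x-degree over the two sets.
  Δ-bosonic : ∀ i → Δ (f i) ≈ ∑[ k + ℓ ≡ i ] (f k ⊗ f ℓ)
  Δ-bosonic i u v = begin
    𝚲.coef (f i) (u ++ v)
      ≡⟨ trans (f-gen i (u ++ v)) (gen-++ κ i 0 u v) ⟩
    D * (δ (θdeg u ℕ.+ θdeg v) 0 * (U * V))
      ≡⟨ cong (λ z → D * (z * (U * V))) (δ-+-0 (θdeg u) (θdeg v)) ⟩
    D * ((A * B) * (U * V))
      ≡⟨ solve 5 (λ d a b x y → d :* ((a :* b) :* (x :* y)) := d :* ((a :* x) :* (b :* y))) refl D A B U V ⟩
    D * ((A * U) * (B * V))
      ≡⟨ convolution i (xdeg u) (xdeg v) (A * U) (B * V) ⟨
    ∑ (upTo (suc i)) (λ k → gen κ k 0 u * gen κ (i ∸ k) 0 v)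
      ≡⟨ ∑-cong (upTo (suc i)) (λ k → trans (inˣ-⊛-inʸ (𝚲.coef (f k)) (𝚲.coef (f (i ∸ k))) u v)
           (cong₂ _*_ (f-gen k u) (f-gen (i ∸ k) v))) ⟨
    ∑ (upTo (suc i)) (λ k → 𝚲⊗𝚲.coef (f k ⊗ f (i ∸ k)) u v)
      ≡⟨ ∑⊗-coef i (λ k ℓ → f k ⊗ f ℓ) u v ⟨
    𝚲⊗𝚲.coef (∑[ k + ℓ ≡ i ] (f k ⊗ f ℓ)) u v ∎
    where
    D = δ (xdeg u ℕ.+ xdeg v) i
    A = δ (θdeg u) 0
    B = δ (θdeg v) 0
    U = weight κ u
    V = weight κ v

  Δ-fermionic : ∀ i → Δ (f̃ i) ≈ ∑[ k + ℓ ≡ i ] (f̃ k ⊗ f ℓ ⊕ f ℓ ⊗ f̃ k)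
  Δ-fermionic i u v = begin
    𝚲.coef (f̃ i) (u ++ v)
      ≡⟨ trans (f̃-gen i (u ++ v)) (gen-++ κ i 1 u v) ⟩
    D * (δ (θdeg u ℕ.+ θdeg v) 1 * (U * V))
      ≡⟨ cong (λ z → D * (z * (U * V))) (δ-+-1 (θdeg u) (θdeg v)) ⟩
    D * ((A₁ * B₀ + A₀ * B₁) * (U * V))
      ≡⟨ solve 7 (λ d a₁ b₀ a₀ b₁ x y → d :* ((a₁ :* b₀ :+ a₀ :* b₁) :* (x :* y)) :=
           d :* ((a₁ :* x) :* (b₀ :* y)) :+ d :* ((b₁ :* y) :* (a₀ :* x))) refl D A₁ B₀ A₀ B₁ U V ⟩
    D * ((A₁ * U) * (B₀ * V)) + D * ((B₁ * V) * (A₀ * U))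
      ≡⟨ cong₂ _+_ (sym (convolution i (xdeg u) (xdeg v) (A₁ * U) (B₀ * V)))
           -- In this summand the θ belongs to `v`, so `xdeg v` takes the index `k` of `f̃ k`, and
           -- the degrees are exchanged before `convolution` applies.
           (trans (cong (λ p → δ p i * ((B₁ * V) * (A₀ * U))) (ℕ.+-comm (xdeg u) (xdeg v)))
             (sym (convolution i (xdeg v) (xdeg u) (B₁ * V) (A₀ * U)))) ⟩
    ∑ ks (λ k → gen κ k 1 u * gen κ (i ∸ k) 0 v) + ∑ ks (λ k → gen κ k 1 v * gen κ (i ∸ k) 0 u)
      ≡⟨ ∑-+ ks (λ k → gen κ k 1 u * gen κ (i ∸ k) 0 v) (λ k → gen κ k 1 v * gen κ (i ∸ k) 0 u) ⟨
    ∑ ks (λ k → gen κ k 1 u * gen κ (i ∸ k) 0 v + gen κ k 1 v * gen κ (i ∸ k) 0 u)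
      ≡⟨ ∑-cong ks (λ k → cong₂ _+_
           (trans (inˣ-⊛-inʸ (𝚲.coef (f̃ k)) (𝚲.coef (f (i ∸ k))) u v) (cong₂ _*_ (f̃-gen k u) (f-gen (i ∸ k) v)))
           -- The coefficient of a pure tensor is the plain product of coefficients, without a sign,
           -- so exchanging the factors is commutativity in `ℚ`.
           (trans (inˣ-⊛-inʸ (𝚲.coef (f (i ∸ k))) (𝚲.coef (f̃ k)) u v)
             (trans (cong₂ _*_ (f-gen (i ∸ k) u) (f̃-gen k v)) (ℚ.*-comm (gen κ (i ∸ k) 0 u) (gen κ k 1 v))))) ⟨
    ∑ ks (λ k → 𝚲⊗𝚲.coef (f̃ k ⊗ f (i ∸ k) ⊕ f (i ∸ k) ⊗ f̃ k) u v)
      ≡⟨ ∑⊗-coef i (λ k ℓ → f̃ k ⊗ f ℓ ⊕ f ℓ ⊗ f̃ k) u v ⟨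
    𝚲⊗𝚲.coef (∑[ k + ℓ ≡ i ] (f̃ k ⊗ f ℓ ⊕ f ℓ ⊗ f̃ k)) u v ∎
    where
    ks = upTo (suc i)
    D  = δ (xdeg u ℕ.+ xdeg v) i
    A₀ = δ (θdeg u) 0
    A₁ = δ (θdeg u) 1
    B₀ = δ (θdeg v) 0
    B₁ = δ (θdeg v) 1
    U  = weight κ u
    V  = weight κ v

proposition4p1 : (∀ (i : ℕ) → 1 ≤ i → Δ (e i) ≈ ∑[ k + ℓ ≡ i ] (e k ⊗ e ℓ))
    × (∀ (i : ℕ) → Δ (ẽ i) ≈ ∑[ k + ℓ ≡ i ] (ẽ k ⊗ e ℓ ⊕ e ℓ ⊗ ẽ k))
    × (∀ (i : ℕ) → 1 ≤ i → Δ (h i) ≈ ∑[ k + ℓ ≡ i ] (h k ⊗ h ℓ))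
    × (∀ (i : ℕ) → Δ (h̃ i) ≈ ∑[ k + ℓ ≡ i ] (h̃ k ⊗ h ℓ ⊕ h ℓ ⊗ h̃ k))
proposition4p1 =
  (λ i _ → Δ-bosonic κᵉ e ẽ e-gen ẽ-gen i) ,
  Δ-fermionic κᵉ e ẽ e-gen ẽ-gen ,
  (λ i _ → Δ-bosonic κʰ h h̃ h-gen h̃-gen i) ,
  Δ-fermionic κʰ h h̃ h-gen h̃-gen
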